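{- Let $G$ be a $3$-regular graph of order $n\ge 6$ with no component isomorphic to $K_{3,3}$. Then $\gamma_P(G)\cdot\gamma_P(\overline{G})\le 2\left\lfloor\frac{n}{4}\right\rfloor$, where $\overline{G}$ is the complement of $G$, and this bound is attained for arbitrarily large $n$.
   Context: All graphs are finite, simple, undirected, with nonempty vertex set; the order is the number of vertices. $N(v)$ is the set of neighbors of $v$, $N[v]=N(v)\cup\{v\}$, and $N[S]=\bigcup_{v\in S}N[v]$. For $S\subseteq V(G)$, define $PD(S)$ by: (1) start with $PD(S):=N[S]$; (2) while there exists $v\in PD(S)$ with $|N(v)\setminus PD(S)|=1$, set $PD(S):=PD(S)\cup N(v)$. $S$ is a power dominating set if $PD(S)=V(G)$ at the end of the process. The power domination number $\gamma_P(G)$ is the minimum cardinality of a power dominating set of $G$. -}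

module Defs where

open import Data.Bool using (Bool; true; false; _xor_)
import Data.Bool.Properties as Bool
open import Data.Fin using (Fin; toℕ)
open import Data.Fin.Properties using (any?)
open import Data.Fin.Subset
open import Data.Fin.Subset.Induction using (⊃-wellFounded)
open import Data.Fin.Subset.Properties
open import Data.List using (filter; allFin; map)
open import Data.List.Membership.Propositional using () renaming (_∈_ to _∈ˡ_)
open import Data.List.Membership.Propositional.Properties using (∈-map⁺; ∈-filter⁺; ∈-allFin)
open import Data.List.Relation.Unary.Any using (here; there)
open import Data.Nat using (ℕ; zero; suc; _+_; _≤_; z≤n; s≤s; _<?_; _≟_)
import Data.Nat.Properties as ℕ
open import Data.Product using (∃; ∃-syntax; _×_; _,_; proj₁; proj₂)
open import Data.Sum using (inj₁; inj₂; [_,_]′)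
open import Data.Vec using ([]; _∷_; here; there; tabulate)
import Data.Vec.Properties as Vec
open import Function using (_∘_; _⇔_; _↔_; Inverse)
open import Induction.WellFounded using (Acc; acc)
open import Relation.Binary.Construct.Closure.ReflexiveTransitive using (Star; ε; _◅_)
open import Relation.Binary.PropositionalEquality
open import Relation.Nullary using (¬_; yes; no; does; contradiction)
open import Relation.Nullary.Decidable using (_×-dec_)
open import Relation.Unary using (Decidable)

private
  variable
    n m : ℕ

-- A simple graph with vertex set Fin n; N v is the open neighbourhood of v,
-- so w ∈ N v says that v and w are adjacent.
record Graph (n : ℕ) : Set where
  field
    N           : Fin n → Subset n
    symmetric   : ∀ {v w} → w ∈ N v → v ∈ N w
    irreflexive : ∀ {v} → v ∉ N v

  N[_] : Fin n → Subset n
  N[ v ] = N v ∪ ⁅ v ⁆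

  N[[_]] : Subset n → Subset n
  N[[ S ]] = ⋃ (map N[_] (filter (_∈? S) (allFin n)))

  Adj : Fin n → Fin n → Set
  Adj v w = w ∈ N v

open Graph

IsRegular : ℕ → Graph n → Set
IsRegular k G = ∀ v → ∣ N G v ∣ ≡ k

complement : Graph n → Graph n
complement G = record
  { N           = λ v → ∁ (N[_] G v)
  ; symmetric   = λ {v} {w} w∈ → x∉p⇒x∈∁p λ v∈ → x∈∁p⇒x∉p w∈ (closed-symmetric v w v∈)
  ; irreflexive = λ {v} v∈ → x∈∁p⇒x∉p v∈ (x∈p∪q⁺ (inj₂ (x∈⁅x⁆ v)))
  }
  where
  closed-symmetric : ∀ v w → v ∈ N[_] G w → w ∈ N[_] G v
  closed-symmetric v w v∈ = x∈p∪q⁺ ([ inj₁ ∘ symmetric G , inj₂ ∘ swap ]′ (x∈p∪q⁻ _ _ v∈))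
    where
    swap : v ∈ ⁅ w ⁆ → w ∈ ⁅ v ⁆
    swap v∈w with refl ← x∈⁅y⁆⇒x≡y w v∈w = x∈⁅x⁆ v

-- K_{a,b}, whose parts are the first a and the last b vertices.
completeBipartite : ∀ a b → Graph (a + b)
completeBipartite a b = record
  { N           = nbrs
  ; symmetric   = λ {v} {w} w∈ →
      ∈⁺ (trans (Bool.xor-comm (left w) (left v)) (∈⁻ w∈))
  ; irreflexive = λ {v} v∈ →
      contradiction (trans (sym (∈⁻ v∈)) (Bool.xor-same (left v))) λ ()
  }
  where
  left : Fin (a + b) → Bool
  left v = does (toℕ v <? a)

  nbrs : Fin (a + b) → Subset (a + b)
  nbrs v = tabulate λ w → left v xor left w

  ∈⁺ : ∀ {v w} → left v xor left w ≡ true → w ∈ nbrs v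
  ∈⁺ {v} {w} eq = Vec.lookup⇒[]= w (nbrs v) (trans (Vec.lookup∘tabulate _ w) eq)

  ∈⁻ : ∀ {v w} → w ∈ nbrs v → left v xor left w ≡ true
  ∈⁻ {v} {w} w∈ = trans (sym (Vec.lookup∘tabulate _ w)) (Vec.[]=⇒lookup w∈)

-- Components are the nonempty classes of the reachability relation.
IsComponent : Graph n → Subset n → Set
IsComponent G C =
  Nonempty C × (∀ {v} → v ∈ C → ∀ w → w ∈ C ⇔ Star (Adj G) v w)

-- An isomorphism from H onto the subgraph of G induced by C.
record _≅_[_] (H : Graph m) (G : Graph n) (C : Subset n) : Set where
  field
    bijection : Fin m ↔ (∃[ v ] v ∈ C)

  vertex : Fin m → Fin n
  vertex x = proj₁ (Inverse.to bijection x)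

  field
    adjacency : ∀ x y → Adj H x y ⇔ Adj G (vertex x) (vertex y)

HasComponentIsoTo : Graph n → Graph m → Set
HasComponentIsoTo G H = ∃[ C ] IsComponent G C × H ≅ G [ C ]

module _ (G : Graph n) where

  -- P is the current value of PD(S) in the loop.
  Active : Subset n → Fin n → Set
  Active P v = v ∈ P × ∣ N G v ─ P ∣ ≡ 1

  active? : ∀ P → Decidable (Active P)
  active? P v = v ∈? P ×-dec ∣ N G v ─ P ∣ ≟ 1

  data _⟶_ (P : Subset n) : Subset n → Set where
    step : ∀ {v} → Active P v → P ⟶ (P ∪ N G v)

  Final : Subset n → Set
  Final P = ∀ v → ¬ Active P v

  active⇒⊃ : ∀ {P v} → Active P v → (P ∪ N G v) ⊃ P
  active⇒⊃ {P} {v} (_ , eq) with nonempty? (N G v ─ P)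
  ... | yes (x , x∈) =
    p⊆p∪q (N G v) , x , x∈p∪q⁺ (inj₂ (p─q⊆p (N G v) P x∈)) , ∈─⇒∉ (N G v) P x∈
    where
    ∈─⇒∉ : ∀ {k} {y : Fin k} (p q : Subset k) → y ∈ p ─ q → y ∉ q
    ∈─⇒∉ (_ ∷ p) (_ ∷ q) (there y∈) (there y∈q) = ∈─⇒∉ p q y∈ y∈q
  ... | no empty = contradiction
    (trans (sym eq) (trans (cong ∣_∣ (Empty-unique empty)) (∣⊥∣≡0 n))) λ ()

  run : ∀ P → Acc _⊃_ P → ∃[ Q ] Star _⟶_ P Q × Final Q
  run P (acc rec) with any? (active? P)
  ... | no none      = P , ε , λ v a → none (v , a)
  ... | yes (v , a) with run (P ∪ N G v) (rec (active⇒⊃ a))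
  ...   | Q , P⟶*Q , final = Q , step a ◅ P⟶*Q , final

  -- PD(S) at the end of the process. The choice of active vertices made by
  -- run is immaterial, by PD-unique.
  PD : Subset n → Subset n
  PD S = proj₁ (run (N[[_]] G S) (⊃-wellFounded _))

  PD-reachable : ∀ S → Star _⟶_ (N[[_]] G S) (PD S)
  PD-reachable S = proj₁ (proj₂ (run (N[[_]] G S) (⊃-wellFounded _)))

  PD-final : ∀ S → Final (PD S)
  PD-final S = proj₂ (proj₂ (run (N[[_]] G S) (⊃-wellFounded _)))

  reachable⇒⊇ : ∀ {P Q} → Star _⟶_ P Q → P ⊆ Q
  reachable⇒⊇ ε                      x∈P = x∈P
  reachable⇒⊇ (step {v} _ ◅ P∪N⟶*Q) x∈P =
    reachable⇒⊇ P∪N⟶*Q (p⊆p∪q (N G v) x∈P)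

  reachable⇒⊆final : ∀ {P P′ Q} → Star _⟶_ P P′ → P ⊆ Q → Final Q → P′ ⊆ Q
  reachable⇒⊆final ε P⊆Q _ = P⊆Q
  reachable⇒⊆final {P} {Q = Q} (step {v} (v∈P , eq) ◅ ⟶*) P⊆Q final =
    reachable⇒⊆final ⟶* (λ x∈ → [ P⊆Q , N⊆Q ]′ (x∈p∪q⁻ P (N G v) x∈)) final
    where
    ─-antitone : ∀ {k} (p : Subset k) {q r} → q ⊆ r → ∣ p ─ r ∣ ≤ ∣ p ─ q ∣
    ─-antitone []            {[]}          {[]}          _   = z≤n
    ─-antitone (_       ∷ p) {inside  ∷ q} {inside  ∷ r} q⊆r = ─-antitone p (drop-∷-⊆ q⊆r)
    ─-antitone (_       ∷ p) {inside  ∷ q} {outside ∷ r} q⊆r = contradiction (q⊆r here) λ ()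
    ─-antitone (inside  ∷ p) {outside ∷ q} {inside  ∷ r} q⊆r =
      ℕ.m≤n⇒m≤1+n (─-antitone p (drop-∷-⊆ q⊆r))
    ─-antitone (outside ∷ p) {outside ∷ q} {inside  ∷ r} q⊆r = ─-antitone p (drop-∷-⊆ q⊆r)
    ─-antitone (inside  ∷ p) {outside ∷ q} {outside ∷ r} q⊆r = s≤s (─-antitone p (drop-∷-⊆ q⊆r))
    ─-antitone (outside ∷ p) {outside ∷ q} {outside ∷ r} q⊆r = ─-antitone p (drop-∷-⊆ q⊆r)

    N⊆Q : N G v ⊆ Q
    N⊆Q {x} x∈N with x ∈? Q
    ... | yes x∈Q = x∈Q
    ... | no x∉Q  = contradiction (P⊆Q v∈P , ℕ.≤-antisym ≤1 ≥1) (final v)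
      where
      ≤1 : ∣ N G v ─ Q ∣ ≤ 1
      ≤1 = subst (∣ N G v ─ Q ∣ ≤_) eq (─-antitone (N G v) P⊆Q)

      ≥1 : 1 ≤ ∣ N G v ─ Q ∣
      ≥1 = ℕ.≤-trans (s≤s z≤n) (x∈p⇒∣p-x∣<∣p∣ (x∈p∧x∉q⇒x∈p─q x∈N x∉Q))

  PD-unique : ∀ {S Q} → Star _⟶_ (N[[_]] G S) Q → Final Q → Q ≡ PD S
  PD-unique {S} ⟶*Q final = ⊆-antisym
    (reachable⇒⊆final ⟶*Q (reachable⇒⊇ (PD-reachable S)) (PD-final S))
    (reachable⇒⊆final (PD-reachable S) (reachable⇒⊇ ⟶*Q) final)

  IsPowerDominating : Subset n → Set
  IsPowerDominating S = PD S ≡ ⊤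

  isPowerDominating? : Decidable IsPowerDominating
  isPowerDominating? S = Vec.≡-dec Bool._≟_ (PD S) ⊤

  ⊤-isPowerDominating : IsPowerDominating ⊤
  ⊤-isPowerDominating = ⊆-antisym ⊆⊤ λ {x} _ → reachable⇒⊇ (PD-reachable ⊤)
    (∈-⋃ (∈-map⁺ (N[_] G) (∈-filter⁺ (_∈? ⊤) (∈-allFin x) ∈⊤))
      (x∈p∪q⁺ (inj₂ (x∈⁅x⁆ x))))
    where
    ∈-⋃ : ∀ {x : Fin n} {p ps} → p ∈ˡ ps → x ∈ p → x ∈ ⋃ ps
    ∈-⋃ (here refl) x∈p = x∈p∪q⁺ (inj₁ x∈p)
    ∈-⋃ (there p∈)  x∈p = x∈p∪q⁺ (inj₂ (∈-⋃ p∈ x∈p))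

  IsPowerDominationNumber : ℕ → Set
  IsPowerDominationNumber k =
    (∃[ S ] IsPowerDominating S × ∣ S ∣ ≡ k) ×
    (∀ S → IsPowerDominating S → k ≤ ∣ S ∣)

  powerDominationNumber : ∃ IsPowerDominationNumber
  powerDominationNumber =
    let k , attained , min = least attained? ∣ ⊤ {n = n} ∣ (⊤ , ⊤-isPowerDominating , refl)
    in  k , attained , λ S dom → min ∣ S ∣ (S , dom , refl)
    where
    Attained : ℕ → Set
    Attained k = ∃[ S ] IsPowerDominating S × ∣ S ∣ ≡ k

    attained? : Decidable Attained
    attained? k = anySubset? λ S → isPowerDominating? S ×-dec ∣ S ∣ ≟ k

    least : ∀ {P : ℕ → Set} → Decidable P → ∀ k → P k →
            ∃[ l ] P l × (∀ j → P j → l ≤ j)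
    least P? zero    p = zero , p , λ _ _ → z≤n
    least P? (suc k) p with P? zero
    ... | yes p₀ = zero , p₀ , λ _ _ → z≤n
    ... | no ¬p₀ with least (P? ∘ suc) k p
    ...   | l , pl , min = suc l , pl , λ where
      zero    p₀ → contradiction p₀ ¬p₀
      (suc j) pj → s≤s (min j pj)

  γP : ℕ
  γP = proj₁ powerDominationNumber

  γP-correct : IsPowerDominationNumber γP
  γP-correct = proj₂ powerDominationNumber

{-# OPTIONS --safe #-}

-- Let G be cubic. If u and v have at most one common neighbour in G, then {u, v} dominates all but
-- at most one vertex of the complement, and that vertex is forced; so γP of the complement is ≤ 2.
--
-- For γP G ≤ n / 4, call P saturated if no forcing step applies and each vertex of P has a
-- neighbour in P. Then each vertex of P has zero or two neighbours outside P, and counting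
-- degrees mod 2 shows that |P| is even. Add vertices u outside PD(S) one at a time: the saturated
-- set PD(S) grows by an even number, and if it grows by less than four then it grows by u and a
-- twin u′ of u (a vertex with the same neighbours apart from u and u′). This cannot happen if S
-- contains a maximal family of vertices with a twin whose closed neighbourhoods are disjoint:
-- N[u] meets N[s] for some s in the family, and then u, u′ and s span a K₃,₃ component.
--
-- Equality holds for disjoint unions of at least two copies of K₄.
module Submission where

open import Algebra.Bundles using (CommutativeRing)
open import Data.Bool using (Bool; true; false; not; _∧_; _xor_)
import Data.Bool.Properties as Bool
-- Sums are taken in the field with two elements, so they compute parities.
open import Algebra.Properties.Semiring.Sum (CommutativeRing.semiring Bool.xor-∧-commutativeRing)
  using (sum; sum-cong-≗; ∑-distrib-+; *-distribˡ-sum)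
open import Data.Fin using (Fin; zero; suc; toℕ; join; splitAt; combine; quotient; remainder; fromℕ<)
import Data.Fin.Properties as Fin
open import Data.Fin.Subset
open import Data.Fin.Subset.Induction using (⊃-wellFounded)
open import Data.Fin.Subset.Properties
open import Data.List using (List; []; _∷_; allFin; map)
open import Data.List.Membership.Propositional using () renaming (_∈_ to _∈ˡ_)
open import Data.List.Membership.Propositional.Properties using (∈-filter⁺; ∈-filter⁻; ∈-allFin)
open import Data.List.Relation.Unary.Any using (here; there)
open import Data.Nat using (ℕ; zero; suc; _+_; _*_; _≤_; _<_; _<?_; _≥_; z≤n; s≤s)
open import Data.Nat.DivMod using (_/_; m*n/n≡m; /-monoˡ-≤)
import Data.Nat.Properties as ℕ
open import Data.Product using (∃-syntax; _×_; _,_; proj₁; proj₂)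
open import Data.Product.Properties using (Σ-≡,≡→≡)
open import Data.Sum using (_⊎_; inj₁; inj₂; [_,_]′)
open import Data.Vec using (Vec; []; _∷_; here; there; lookup; tabulate)
open import Data.Vec.Membership.Propositional using () renaming (_∈_ to _∈ᵛ_)
open import Data.Vec.Membership.Propositional.Properties using (∈-tabulate⁺)
import Data.Vec.Properties as Vec
open import Data.Vec.Properties.WithK using ([]=-irrelevant)
open import Data.Vec.Relation.Unary.All as All using (All; []; _∷_)
import Data.Vec.Relation.Unary.All.Properties as All
open import Data.Vec.Relation.Unary.AllPairs using ([]; _∷_)
open import Data.Vec.Relation.Unary.Any as Any using (here; there)
import Data.Vec.Relation.Unary.Any.Properties as Any
open import Data.Vec.Relation.Unary.Unique.Propositional using (Unique)
import Data.Vec.Relation.Unary.Unique.Propositional.Properties as Unique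
open import Function using (_∘_; _⇔_; mk⇔; mk⤖; Equivalence; Inverse)
open import Function.Consequences.Propositional using (strictlySurjective⇒surjective)
open import Function.Construct.Composition using (_⇔-∘_)
open import Function.Construct.Symmetry using (⇔-sym)
open import Function.Properties.Bijection using (⤖⇒↔)
open import Induction.WellFounded using (Acc; acc)
open import Relation.Binary.Construct.Closure.ReflexiveTransitive using (Star; ε; _◅_)
open import Relation.Binary.PropositionalEquality
open import Relation.Nullary using (¬_; Dec; yes; no; does; contradiction)
open import Relation.Nullary.Decidable using (dec-true; dec-false; decidable-stable; _×-dec_; ¬?)
open import Defs

private
  variable
    k n : ℕ
    p q r : Subset n
    x y : Fin n

-- Cardinalities and enumerations of finite subsets.

x∈p─q⇒x∉q : ∀ (p q : Subset n) → x ∈ p ─ q → x ∉ q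
x∈p─q⇒x∉q (_ ∷ p) (_ ∷ q) (there x∈) (there x∈q) = x∈p─q⇒x∉q p q x∈ x∈q

x∈p-y⇒x≢y : ∀ (p : Subset n) {y} → x ∈ p - y → x ≢ y
x∈p-y⇒x≢y p x∈ refl = x∈p─q⇒x∉q p _ x∈ (x∈⁅x⁆ _)

∣p∣≡1+∣p-x∣ : x ∈ p → ∣ p ∣ ≡ suc ∣ p - x ∣
∣p∣≡1+∣p-x∣ {p = _ ∷ p} here = cong (suc ∘ ∣_∣) (sym (p─⊥≡p p))
∣p∣≡1+∣p-x∣ {p = true  ∷ _} (there x∈) = cong suc (∣p∣≡1+∣p-x∣ x∈)
∣p∣≡1+∣p-x∣ {p = false ∷ _} (there x∈) = ∣p∣≡1+∣p-x∣ x∈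

∣p∣≤1+∣p-x∣ : ∀ (p : Subset n) x → ∣ p ∣ ≤ suc ∣ p - x ∣
∣p∣≤1+∣p-x∣ p x with x ∈? p
... | yes x∈ = ℕ.≤-reflexive (∣p∣≡1+∣p-x∣ x∈)
... | no x∉  = ℕ.m≤n⇒m≤1+n (p⊆q⇒∣p∣≤∣q∣ {p = p} {p - x} λ y∈ →
  x∈p∧x≢y⇒x∈p-y y∈ λ { refl → x∉ y∈ })

∣p∣≡0⇒Empty : ∣ p ∣ ≡ 0 → Empty p
∣p∣≡0⇒Empty eq (_ , x∈) = contradiction (trans (sym eq) (∣p∣≡1+∣p-x∣ x∈)) λ ()

Empty⇒∣p∣≡0 : {p : Subset n} → Empty p → ∣ p ∣ ≡ 0
Empty⇒∣p∣≡0 {n} empty = trans (cong ∣_∣ (Empty-unique empty)) (∣⊥∣≡0 n)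

∣p∣≥1⇒Nonempty : {p : Subset n} → 1 ≤ ∣ p ∣ → Nonempty p
∣p∣≥1⇒Nonempty {p = p} 1≤ with nonempty? p
... | yes nonempty = nonempty
... | no empty     = contradiction (ℕ.≤-trans 1≤ (ℕ.≤-reflexive (Empty⇒∣p∣≡0 empty))) λ ()

∣p∪q∣≤∣p∣+∣q∣ : ∀ (p q : Subset n) → ∣ p ∪ q ∣ ≤ ∣ p ∣ + ∣ q ∣
∣p∪q∣≤∣p∣+∣q∣ []          []          = z≤n
∣p∪q∣≤∣p∣+∣q∣ (true  ∷ p) (true  ∷ q) =
  s≤s (ℕ.≤-trans (∣p∪q∣≤∣p∣+∣q∣ p q) (ℕ.+-monoʳ-≤ ∣ p ∣ (ℕ.n≤1+n _)))
∣p∪q∣≤∣p∣+∣q∣ (true  ∷ p) (false ∷ q) = s≤s (∣p∪q∣≤∣p∣+∣q∣ p q)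
∣p∪q∣≤∣p∣+∣q∣ (false ∷ p) (true  ∷ q) =
  ℕ.≤-trans (s≤s (∣p∪q∣≤∣p∣+∣q∣ p q)) (ℕ.≤-reflexive (sym (ℕ.+-suc ∣ p ∣ ∣ q ∣)))
∣p∪q∣≤∣p∣+∣q∣ (false ∷ p) (false ∷ q) = ∣p∪q∣≤∣p∣+∣q∣ p q

disjoint⇒∣p∣+∣q∣≤∣p∪q∣ : ∀ (p q : Subset n) → Empty (p ∩ q) → ∣ p ∣ + ∣ q ∣ ≤ ∣ p ∪ q ∣
disjoint⇒∣p∣+∣q∣≤∣p∪q∣ []          []          _        = z≤n
disjoint⇒∣p∣+∣q∣≤∣p∪q∣ (true  ∷ p) (true  ∷ q) disjoint = contradiction (zero , here) disjoint
disjoint⇒∣p∣+∣q∣≤∣p∪q∣ (true  ∷ p) (false ∷ q) disjoint =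
  s≤s (disjoint⇒∣p∣+∣q∣≤∣p∪q∣ p q (drop-∷-Empty disjoint))
disjoint⇒∣p∣+∣q∣≤∣p∪q∣ (false ∷ p) (true  ∷ q) disjoint =
  ℕ.≤-trans (ℕ.≤-reflexive (ℕ.+-suc ∣ p ∣ ∣ q ∣))
    (s≤s (disjoint⇒∣p∣+∣q∣≤∣p∪q∣ p q (drop-∷-Empty disjoint)))
disjoint⇒∣p∣+∣q∣≤∣p∪q∣ (false ∷ p) (false ∷ q) disjoint =
  disjoint⇒∣p∣+∣q∣≤∣p∪q∣ p q (drop-∷-Empty disjoint)

∣p∣≡∣p∩q∣+∣p─q∣ : ∀ (p q : Subset n) → ∣ p ∣ ≡ ∣ p ∩ q ∣ + ∣ p ─ q ∣
∣p∣≡∣p∩q∣+∣p─q∣ []          []          = refl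
∣p∣≡∣p∩q∣+∣p─q∣ (true  ∷ p) (true  ∷ q) = cong suc (∣p∣≡∣p∩q∣+∣p─q∣ p q)
∣p∣≡∣p∩q∣+∣p─q∣ (true  ∷ p) (false ∷ q) =
  trans (cong suc (∣p∣≡∣p∩q∣+∣p─q∣ p q)) (sym (ℕ.+-suc ∣ p ∩ q ∣ ∣ p ─ q ∣))
∣p∣≡∣p∩q∣+∣p─q∣ (false ∷ p) (true  ∷ q) = ∣p∣≡∣p∩q∣+∣p─q∣ p q
∣p∣≡∣p∩q∣+∣p─q∣ (false ∷ p) (false ∷ q) = ∣p∣≡∣p∩q∣+∣p─q∣ p q

q⊆p⇒∣p∣≡∣q∣+∣p─q∣ : ∀ (p q : Subset n) → q ⊆ p → ∣ p ∣ ≡ ∣ q ∣ + ∣ p ─ q ∣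
q⊆p⇒∣p∣≡∣q∣+∣p─q∣ p q q⊆p = trans (∣p∣≡∣p∩q∣+∣p─q∣ p q) (cong (λ r → ∣ r ∣ + ∣ p ─ q ∣)
  (⊆-antisym (p∩q⊆q p q) λ x∈ → x∈p∩q⁺ (q⊆p x∈ , x∈)))

─-monoʳ-⊇ : ∀ (p : Subset n) → q ⊆ r → p ─ r ⊆ p ─ q
─-monoʳ-⊇ {r = r} p q⊆r x∈ = x∈p∧x∉q⇒x∈p─q (p─q⊆p p r x∈) (x∈p─q⇒x∉q p r x∈ ∘ q⊆r)

private
  remove-all : {xs : Vec (Fin n) k} → All (x ≢_) xs → All (_∈ p) xs → All (_∈ p - x) xs
  remove-all x≢xs xs∈p =
    All.map (λ (y∈ , x≢y) → x∈p∧x≢y⇒x∈p-y y∈ (x≢y ∘ sym)) (All.zip (xs∈p , x≢xs))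

Unique⇒length≤∣p∣ : {xs : Vec (Fin n) k} → Unique xs → All (_∈ p) xs → k ≤ ∣ p ∣
Unique⇒length≤∣p∣ []                []           = z≤n
Unique⇒length≤∣p∣ (x≢xs ∷ unique) (x∈ ∷ xs∈) = ℕ.≤-trans
  (s≤s (Unique⇒length≤∣p∣ unique (remove-all x≢xs xs∈))) (ℕ.≤-reflexive (sym (∣p∣≡1+∣p-x∣ x∈)))

-- Turns a bound on a size or a degree into a finite case split: once `k` distinct members are
-- known, any further member must be one of them.
Unique⇒exhausts : {xs : Vec (Fin n) k} → Unique xs → All (_∈ p) xs → ∣ p ∣ ≤ k →
                  y ∈ p → y ∈ᵛ xs
Unique⇒exhausts [] [] ∣p∣≤0 y∈ = contradiction (_ , y∈) (∣p∣≡0⇒Empty (ℕ.n≤0⇒n≡0 ∣p∣≤0))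
Unique⇒exhausts {y = y} {xs = x ∷ _} (x≢xs ∷ unique) (x∈ ∷ xs∈) ∣p∣≤k y∈ with y Fin.≟ x
... | yes y≡x = here y≡x
... | no  y≢x = there (Unique⇒exhausts unique (remove-all x≢xs xs∈)
  (ℕ.≤-pred (ℕ.≤-trans (ℕ.≤-reflexive (sym (∣p∣≡1+∣p-x∣ x∈))) ∣p∣≤k)) (x∈p∧x≢y⇒x∈p-y y∈ y≢x))

covered⇒∣p∣≤length : {p : Subset n} {xs : Vec (Fin n) k} → (∀ {y} → y ∈ p → y ∈ᵛ xs) → ∣ p ∣ ≤ k
covered⇒∣p∣≤length {xs = []} covered =
  ℕ.≤-reflexive (Empty⇒∣p∣≡0 λ { (_ , y∈) → contradiction (covered y∈) λ () })
covered⇒∣p∣≤length {p = p} {xs = x ∷ xs} covered =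
  ℕ.≤-trans (∣p∣≤1+∣p-x∣ p x) (s≤s (covered⇒∣p∣≤length λ y∈ →
    drop-head y∈ (covered (p─q⊆p p ⁅ x ⁆ y∈))))
  where
  drop-head : ∀ {y} → y ∈ p - x → y ∈ᵛ x ∷ xs → y ∈ᵛ xs
  drop-head y∈ (here y≡x)  = contradiction y≡x (x∈p-y⇒x≢y p y∈)
  drop-head y∈ (there y∈xs) = y∈xs

∣p∣<n⇒∃∉ : ∀ (p : Subset n) → ∣ p ∣ < n → ∃[ x ] x ∉ p
∣p∣<n⇒∃∉ {n} p ∣p∣<n with Fin.any? (λ x → ¬? (x ∈? p))
... | yes found = found
... | no none   = contradiction (subst (_< n) (trans (cong ∣_∣ p≡⊤) (∣⊤∣≡n n)) ∣p∣<n)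
  (ℕ.<-irrefl refl)
  where
  p≡⊤ : p ≡ ⊤
  p≡⊤ = ⊆-antisym ⊆⊤ λ {y} _ → decidable-stable (y ∈? p) λ y∉ → none (y , y∉)

elements : ∀ k (p : Subset n) → ∣ p ∣ ≡ k → ∃[ xs ] Unique {n = k} xs × All (_∈ p) xs
elements zero    p eq = [] , [] , []
elements (suc k) p eq =
  let x , x∈ = ∣p∣≥1⇒Nonempty (ℕ.≤-trans (s≤s z≤n) (ℕ.≤-reflexive (sym eq)))
      xs , unique , xs∈ = elements k (p - x) (ℕ.suc-injective (trans (sym (∣p∣≡1+∣p-x∣ x∈)) eq))
  in  x ∷ xs , All.map (λ y∈ → x∈p-y⇒x≢y p y∈ ∘ sym) xs∈ ∷ unique
    , x∈ ∷ All.map (p─q⊆p p _) xs∈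

∈-tabulate : {f : Fin n → Bool} → x ∈ tabulate f ⇔ f x ≡ true
∈-tabulate {x = x} {f} = mk⇔
  (λ x∈ → trans (sym (Vec.lookup∘tabulate f x)) (Vec.[]=⇒lookup x∈))
  (λ eq → Vec.lookup⇒[]= x _ (trans (Vec.lookup∘tabulate f x) eq))

-- Closed neighbourhoods, the forcing closure and complements.

open Graph

∈-N[[]]⁺ : ∀ (G : Graph n) {S s} → s ∈ S → N[_] G s ⊆ N[[_]] G S
∈-N[[]]⁺ {n} G {S} {s} s∈S {x} x∈ = go (∈-filter⁺ (_∈? S) (∈-allFin s) s∈S)
  where
  go : {ss : List (Fin n)} → s ∈ˡ ss → x ∈ ⋃ (map (N[_] G) ss)
  go (here refl) = x∈p∪q⁺ (inj₁ x∈)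
  go (there s∈)  = x∈p∪q⁺ (inj₂ (go s∈))

∈-N[[]]⁻ : ∀ (G : Graph n) {S x} → x ∈ N[[_]] G S → ∃[ s ] s ∈ S × x ∈ N[_] G s
∈-N[[]]⁻ {n} G {S} {x} x∈ =
  let s , s∈ , x∈ = go _ x∈ in s , proj₂ (∈-filter⁻ (_∈? S) {xs = allFin n} s∈) , x∈
  where
  go : (ss : List (Fin n)) → x ∈ ⋃ (map (N[_] G) ss) → ∃[ s ] s ∈ˡ ss × x ∈ N[_] G s
  go []       x∈ = contradiction x∈ ∉⊥
  go (s ∷ ss) x∈ with x∈p∪q⁻ _ _ x∈
  ... | inj₁ x∈N = s , here refl , x∈N
  ... | inj₂ x∈⋃ = let t , t∈ , x∈N = go ss x∈⋃ in t , there t∈ , x∈N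

module _ {n : ℕ} (G : Graph n) where

  N[[]]-mono : ∀ {S T} → S ⊆ T → N[[_]] G S ⊆ N[[_]] G T
  N[[]]-mono S⊆T x∈ = let s , s∈ , x∈N = ∈-N[[]]⁻ G x∈ in ∈-N[[]]⁺ G (S⊆T s∈) x∈N

  N[[]]⊆PD : ∀ S → N[[_]] G S ⊆ PD G S
  N[[]]⊆PD S = reachable⇒⊇ G (PD-reachable G S)

  N[]⊆PD : ∀ {S s} → s ∈ S → N[_] G s ⊆ PD G S
  N[]⊆PD {S} s∈S = N[[]]⊆PD S ∘ ∈-N[[]]⁺ G s∈S

  -- Besides monotonicity, this gives the lower bounds: a set `S` fails to power dominate as soon as
  -- some final set contains its closed neighbourhoods and misses a vertex.
  PD-least : ∀ {S Q} → (∀ {s} → s ∈ S → N[_] G s ⊆ Q) → Final G Q → PD G S ⊆ Q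
  PD-least {S} N[]⊆Q = reachable⇒⊆final G (PD-reachable G S) λ x∈ →
    let s , s∈ , x∈ = ∈-N[[]]⁻ G x∈ in N[]⊆Q s∈ x∈

  PD-mono : ∀ {S T} → S ⊆ T → PD G S ⊆ PD G T
  PD-mono {T = T} S⊆T = PD-least (N[]⊆PD ∘ S⊆T) (PD-final G T)

  s∈N[s] : ∀ {s} → s ∈ N[_] G s
  s∈N[s] = x∈p∪q⁺ (inj₂ (x∈⁅x⁆ _))

  N⊆N[] : ∀ {s} → N G s ⊆ N[_] G s
  N⊆N[] = x∈p∪q⁺ ∘ inj₁

  ∈-N[]⁻ : ∀ {s x} → x ∈ N[_] G s → x ≢ s → x ∈ N G s
  ∈-N[]⁻ {s} x∈ x≢s with x∈p∪q⁻ (N G s) ⁅ s ⁆ x∈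
  ... | inj₁ x∈N = x∈N
  ... | inj₂ x∈s = contradiction (x∈⁅y⁆⇒x≡y _ x∈s) x≢s

  ∈-complement : ∀ {s x} → x ≢ s → x ∉ N G s → x ∈ N (complement G) s
  ∈-complement x≢s x∉N = x∉p⇒x∈∁p λ x∈ → x∉N (∈-N[]⁻ x∈ x≢s)

  ∉N⇒∈N[]-complement : ∀ {s x} → x ∉ N G s → x ∈ N[_] (complement G) s
  ∉N⇒∈N[]-complement {s} {x} x∉ with x Fin.≟ s
  ... | yes refl = x∈p∪q⁺ (inj₂ (x∈⁅x⁆ _))
  ... | no x≢s   = x∈p∪q⁺ (inj₁ (∈-complement x≢s x∉))

  γP≤ : ∀ {S} → IsPowerDominating G S → γP G ≤ ∣ S ∣
  γP≤ = proj₂ (γP-correct G) _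

  dominating : ∀ {S} → (∀ x → x ∈ PD G S) → IsPowerDominating G S
  dominating all∈ = ⊆-antisym ⊆⊤ λ _ → all∈ _

-- Parity and the handshake argument.

odd : ℕ → Bool
odd zero    = false
odd (suc n) = not (odd n)

odd-∣p∣ : (p : Subset n) → odd ∣ p ∣ ≡ sum (lookup p)
odd-∣p∣ []          = refl
odd-∣p∣ (true  ∷ p) = cong not (odd-∣p∣ p)
odd-∣p∣ (false ∷ p) = odd-∣p∣ p

-- Modulo two the entries at `(i , j)` and `(j , i)` cancel. The induction splits off the first row
-- and the first column, which have equal sums.
sum-symmetric : (f : Fin n → Fin n → Bool) → (∀ i j → f i j ≡ f j i) → (∀ i → f i i ≡ false) →
                sum (λ i → sum (f i)) ≡ false
sum-symmetric {zero}  f sym-f diag-f = refl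
sum-symmetric {suc n} f sym-f diag-f = begin
  (f zero zero xor row) xor sum (λ i → f (suc i) zero xor sum (f (suc i) ∘ suc))
    ≡⟨ cong₂ (λ b c → (b xor row) xor c) (diag-f zero) (∑-distrib-+ (λ i → f (suc i) zero) _) ⟩
  row xor (sum (λ i → f (suc i) zero) xor sum (λ i → sum (f (suc i) ∘ suc)))
    ≡⟨ cong₂ (λ b c → row xor (b xor c)) (sum-cong-≗ λ i → sym-f (suc i) zero)
         (sum-symmetric (λ i j → f (suc i) (suc j)) (λ i j → sym-f (suc i) (suc j)) (diag-f ∘ suc)) ⟩
  row xor (row xor false)
    ≡⟨ cong (row xor_) (Bool.xor-identityʳ row) ⟩
  row xor row
    ≡⟨ Bool.xor-same row ⟩
  false ∎
  where
  open ≡-Reasoning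
  row = sum (λ j → f zero (suc j))

module _ {n : ℕ} (G : Graph n) where

  Saturated : Subset n → Set
  Saturated P = Final G P × (∀ {x} → x ∈ P → ∃[ y ] y ∈ P × y ∈ N G x)

  -- The handshake lemma in the subgraph induced by `P`: an odd degree minus an even number of
  -- outside neighbours leaves every vertex of `P` with odd degree there, and the number of vertices
  -- of odd degree is even.
  odd-degrees⇒even-∣P∣ : (∀ v → odd ∣ N G v ∣ ≡ true) →
                         ∀ {P} → (∀ {v} → v ∈ P → odd ∣ N G v ─ P ∣ ≡ false) → odd ∣ P ∣ ≡ false
  odd-degrees⇒even-∣P∣ odd-degree {P} even-outside = begin
    odd ∣ P ∣
      ≡⟨ odd-∣p∣ P ⟩
    sum χ
      ≡⟨ sum-cong-≗ row ⟩
    sum (λ v → sum (λ w → χ v ∧ (χ w ∧ a v w)))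
      ≡⟨ sum-symmetric _ f-sym f-diag ⟩
    false ∎
    where
    open ≡-Reasoning
    χ : Fin n → Bool
    χ = lookup P
    a : Fin n → Fin n → Bool
    a v = lookup (N G v)

    a-sym : ∀ v w → a v w ≡ a w v
    a-sym v w with a v w in eq | a w v in eq′
    ... | true  | true  = refl
    ... | false | false = refl
    ... | true  | false =
      trans (sym (Vec.[]=⇒lookup (symmetric G (Vec.lookup⇒[]= w (N G v) eq)))) eq′
    ... | false | true  =
      trans (sym eq) (Vec.[]=⇒lookup (symmetric G (Vec.lookup⇒[]= v (N G w) eq′)))

    f-sym : ∀ v w → χ v ∧ (χ w ∧ a v w) ≡ χ w ∧ (χ v ∧ a w v)
    f-sym v w = begin
      χ v ∧ (χ w ∧ a v w)  ≡⟨ Bool.∧-assoc (χ v) (χ w) _ ⟨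
      (χ v ∧ χ w) ∧ a v w  ≡⟨ cong₂ _∧_ (Bool.∧-comm (χ v) (χ w)) (a-sym v w) ⟩
      (χ w ∧ χ v) ∧ a w v  ≡⟨ Bool.∧-assoc (χ w) (χ v) _ ⟩
      χ w ∧ (χ v ∧ a w v)  ∎

    f-diag : ∀ v → χ v ∧ (χ v ∧ a v v) ≡ false
    f-diag v with a v v in eq
    ... | true  = contradiction (Vec.lookup⇒[]= v (N G v) eq) (irreflexive G)
    ... | false = trans (cong (χ v ∧_) (Bool.∧-zeroʳ (χ v))) (Bool.∧-zeroʳ (χ v))

    lookup-─ : ∀ {k} (q r : Subset k) i →
               lookup q i ≡ (lookup r i ∧ lookup q i) xor lookup (q ─ r) i
    lookup-─ (true  ∷ q) (true  ∷ r) zero = refl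
    lookup-─ (false ∷ q) (true  ∷ r) zero = refl
    lookup-─ (true  ∷ q) (false ∷ r) zero = refl
    lookup-─ (false ∷ q) (false ∷ r) zero = refl
    lookup-─ (_ ∷ q) (_ ∷ r) (suc i) = lookup-─ q r i

    degree : ∀ v → true ≡ sum (λ w → χ w ∧ a v w) xor odd ∣ N G v ─ P ∣
    degree v = begin
      true           ≡⟨ odd-degree v ⟨
      odd ∣ N G v ∣  ≡⟨ odd-∣p∣ (N G v) ⟩
      sum (a v)      ≡⟨ sum-cong-≗ (lookup-─ (N G v) P) ⟩
      sum (λ w → (χ w ∧ a v w) xor lookup (N G v ─ P) w)
        ≡⟨ ∑-distrib-+ (λ w → χ w ∧ a v w) _ ⟩
      sum (λ w → χ w ∧ a v w) xor sum (lookup (N G v ─ P))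
        ≡⟨ cong (sum (λ w → χ w ∧ a v w) xor_) (odd-∣p∣ (N G v ─ P)) ⟨
      sum (λ w → χ w ∧ a v w) xor odd ∣ N G v ─ P ∣ ∎

    -- For `v` in `P` the inner degree is one modulo two, so multiplying by it changes nothing. This
    -- writes the size of `P` as a sum of a symmetric matrix with zero diagonal.
    row : ∀ v → χ v ≡ sum (λ w → χ v ∧ (χ w ∧ a v w))
    row v = trans (inner v) (*-distribˡ-sum (χ v) (λ w → χ w ∧ a v w))
      where
      inner : ∀ v → χ v ≡ χ v ∧ sum (λ w → χ w ∧ a v w)
      inner v with χ v in eq
      ... | false = refl
      ... | true  = trans (degree v) (trans
        (cong (sum (λ w → χ w ∧ a v w) xor_) (even-outside (Vec.lookup⇒[]= v P eq)))
        (Bool.xor-identityʳ _))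

-- Saturated sets and twins in cubic graphs.

module Cubic {n : ℕ} (G : Graph n) (cubic : IsRegular 3 G) where

  neighbour : ∀ v → Nonempty (N G v)
  neighbour v = ∣p∣≥1⇒Nonempty (ℕ.≤-trans (s≤s z≤n) (ℕ.≤-reflexive (sym (cubic v))))

  -- At the start a vertex is adjacent to its dominator, or is a member of `S` and has its own
  -- neighbours in the set. Forcing preserves this, since every new vertex is adjacent to the vertex
  -- that forces it.
  PD-saturated : ∀ S → Saturated G (PD G S)
  PD-saturated S = PD-final G S , go (PD-reachable G S) initial
    where
    HasInner : Subset n → Set
    HasInner P = ∀ {x} → x ∈ P → ∃[ y ] y ∈ P × y ∈ N G x

    initial : HasInner (N[[_]] G S)
    initial {x} x∈ with ∈-N[[]]⁻ G x∈
    ... | s , s∈S , x∈N[s] with x Fin.≟ s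
    ...   | yes refl = let y , y∈ = neighbour x in y , ∈-N[[]]⁺ G s∈S (N⊆N[] G y∈) , y∈
    ...   | no x≢s   = s , ∈-N[[]]⁺ G s∈S (s∈N[s] G) , symmetric G (∈-N[]⁻ G x∈N[s] x≢s)

    go : ∀ {P Q} → Star (_⟶_ G) P Q → HasInner P → HasInner Q
    go ε inner = inner
    go (_◅_ {i = P} (step {v} (v∈P , _)) P⟶*Q) inner = go P⟶*Q λ x∈ →
      [ (λ x∈P → let y , y∈P , y∈N = inner x∈P in y , x∈p∪q⁺ (inj₁ y∈P) , y∈N)
      , (λ x∈N → v , x∈p∪q⁺ (inj₁ v∈P) , symmetric G x∈N) ]′ (x∈p∪q⁻ P (N G v) x∈)

  module _ {P : Subset n} (saturated : Saturated G P) where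

    -- The neighbour inside `P` leaves room for at most two outside, and finality excludes exactly
    -- one.
    outside-0∨2 : x ∈ P → ∣ N G x ─ P ∣ ≡ 0 ⊎ ∣ N G x ─ P ∣ ≡ 2
    outside-0∨2 {x} x∈P = cases ∣ N G x ─ P ∣ refl
      where
      ≤2 : ∣ N G x ─ P ∣ ≤ 2
      ≤2 = let y , y∈P , y∈N = proj₂ saturated x∈P in ℕ.≤-pred (begin
        suc ∣ N G x ─ P ∣  ≤⟨ s≤s (p⊆q⇒∣p∣≤∣q∣ {p = N G x ─ P} {N G x - y} λ z∈ →
                               x∈p∧x≢y⇒x∈p-y (p─q⊆p (N G x) P z∈)
                                 λ { refl → x∈p─q⇒x∉q (N G x) P z∈ y∈P }) ⟩
        suc ∣ N G x - y ∣  ≡⟨ ∣p∣≡1+∣p-x∣ y∈N ⟨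
        ∣ N G x ∣          ≡⟨ cubic x ⟩
        3                  ∎)
        where open ℕ.≤-Reasoning
      cases : ∀ k → ∣ N G x ─ P ∣ ≡ k → ∣ N G x ─ P ∣ ≡ 0 ⊎ ∣ N G x ─ P ∣ ≡ 2
      cases 0 eq = inj₁ eq
      cases 1 eq = contradiction (x∈P , eq) (proj₁ saturated x)
      cases 2 eq = inj₂ eq
      cases (suc (suc (suc k))) eq with s≤s (s≤s ()) ← subst (_≤ 2) eq ≤2

    even-∣saturated∣ : odd ∣ P ∣ ≡ false
    even-∣saturated∣ = odd-degrees⇒even-∣P∣ G (cong odd ∘ cubic)
      ([ cong odd , cong odd ]′ ∘ outside-0∨2)

    few-outside⇒N⊆ : x ∈ P → ∣ N G x ─ P ∣ ≤ 1 → N G x ⊆ P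
    few-outside⇒N⊆ {x} x∈P ≤1 {y} y∈N with y ∈? P
    ... | yes y∈P = y∈P
    ... | no  y∉P with outside-0∨2 x∈P
    ...   | inj₁ eq = contradiction (_ , x∈p∧x∉q⇒x∈p─q y∈N y∉P) (∣p∣≡0⇒Empty eq)
    ...   | inj₂ eq with s≤s () ← subst (_≤ 1) eq ≤1

  -- One equation covers both kinds of twins: it means equal closed neighbourhoods if `u` and `v`
  -- are adjacent, and equal open ones otherwise.
  Twins : Fin n → Fin n → Set
  Twins u v = u ≢ v × N G u - v ≡ N G v - u

  -- Saturated sets have even size, so a small proper extension adds exactly two vertices u and u′.
  -- A vertex of P next to one of them has two neighbours outside P, and these must be u and u′.
  small-extension⇒twins : ∀ {P Q u} → Saturated G P → Saturated G Q → P ⊆ Q →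
    N[_] G u ⊆ Q → u ∉ P → ∣ Q ∣ < ∣ P ∣ + 4 → ∃[ u′ ] u′ ∉ P × Twins u u′
  small-extension⇒twins {P} {Q} {u} satP satQ P⊆Q N[u]⊆Q u∉P ∣Q∣< =
    u′ , u′∉P , u≢u′ , ⊆-antisym N-u⊆N-u′ N-u′⊆N-u
    where
    u∈D : u ∈ Q ─ P
    u∈D = x∈p∧x∉q⇒x∈p─q (N[u]⊆Q (s∈N[s] G)) u∉P

    ∣D∣<4 : ∣ Q ─ P ∣ < 4
    ∣D∣<4 = ℕ.+-cancelˡ-< ∣ P ∣ _ _ (subst (_< ∣ P ∣ + 4) (q⊆p⇒∣p∣≡∣q∣+∣p─q∣ Q P P⊆Q) ∣Q∣<)

    odd-+ : ∀ i j → odd (i + j) ≡ odd i xor odd j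
    odd-+ zero    j = refl
    odd-+ (suc i) j = trans (cong not (odd-+ i j)) (Bool.not-distribˡ-xor (odd i) (odd j))

    even-∣D∣ : odd ∣ Q ─ P ∣ ≡ false
    even-∣D∣ = begin
      odd ∣ Q ─ P ∣                  ≡⟨ cong (_xor odd ∣ Q ─ P ∣) (even-∣saturated∣ satP) ⟨
      odd ∣ P ∣ xor odd ∣ Q ─ P ∣    ≡⟨ odd-+ ∣ P ∣ _ ⟨
      odd (∣ P ∣ + ∣ Q ─ P ∣)        ≡⟨ cong odd (q⊆p⇒∣p∣≡∣q∣+∣p─q∣ Q P P⊆Q) ⟨
      odd ∣ Q ∣                      ≡⟨ even-∣saturated∣ satQ ⟩
      false                          ∎
      where open ≡-Reasoning

    ∣D∣≡2 : ∣ Q ─ P ∣ ≡ 2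
    -- The difference contains `u`, has fewer than four elements and is even; parity makes the cases
    -- one and three absurd.
    ∣D∣≡2 = cases ∣ Q ─ P ∣ refl ∣D∣<4 even-∣D∣
      where
      cases : ∀ k → ∣ Q ─ P ∣ ≡ k → k < 4 → odd k ≡ false → ∣ Q ─ P ∣ ≡ 2
      cases 0 eq _ _ = contradiction (u , u∈D) (∣p∣≡0⇒Empty eq)
      cases 2 eq _ _ = eq
      cases (suc (suc (suc (suc _)))) _ (s≤s (s≤s (s≤s (s≤s ())))) _

    second : Nonempty (Q ─ P - u)
    second = ∣p∣≥1⇒Nonempty (ℕ.≤-pred (ℕ.≤-reflexive (trans (sym ∣D∣≡2) (∣p∣≡1+∣p-x∣ u∈D))))

    u′ = proj₁ second
    u≢u′ : u ≢ u′
    u≢u′ = x∈p-y⇒x≢y (Q ─ P) (proj₂ second) ∘ sym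
    u′∈D : u′ ∈ Q ─ P
    u′∈D = p─q⊆p (Q ─ P) ⁅ u ⁆ (proj₂ second)
    u′∈Q : u′ ∈ Q
    u′∈Q = p─q⊆p Q P u′∈D
    u′∉P : u′ ∉ P
    u′∉P = x∈p─q⇒x∉q Q P u′∈D

    D⊆ : ∀ {x} → x ∈ Q → x ∉ P → x ≡ u ⊎ x ≡ u′
    D⊆ x∈Q x∉P with Unique⇒exhausts ((u≢u′ ∷ []) ∷ [] ∷ []) (u∈D ∷ u′∈D ∷ [])
                     (ℕ.≤-reflexive ∣D∣≡2) (x∈p∧x∉q⇒x∈p─q x∈Q x∉P)
    ... | here x≡u          = inj₁ x≡u
    ... | there (here x≡u′) = inj₂ x≡u′

    both : ∀ {v d e} → v ∈ P → d ∈ N G v → d ∈ Q ─ P → e ∈ Q ─ P → e ∈ N G v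
    both {v} {d} {e} v∈P d∈N d∈D e∈D with e ∈? N G v
    ... | yes e∈N = e∈N
    ... | no  e∉N with outside-0∨2 satP v∈P
    ...   | inj₁ eq = contradiction
      (d , x∈p∧x∉q⇒x∈p─q d∈N (x∈p─q⇒x∉q Q P d∈D)) (∣p∣≡0⇒Empty eq)
    -- Both outside neighbours of `v` lie in `Q ─ P`, but without `e` only one place is left there.
    ...   | inj₂ eq = contradiction (begin-strict
      2                      ≡⟨ eq ⟨
      ∣ N G v ─ P ∣          ≤⟨ p⊆q⇒∣p∣≤∣q∣ {p = N G v ─ P} {Q ─ P - e} (λ x∈ → x∈p∧x≢y⇒x∈p-y
                                 (x∈p∧x∉q⇒x∈p─q (N⊆Q (p─q⊆p (N G v) P x∈))
                                                (x∈p─q⇒x∉q (N G v) P x∈))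
                                 (λ { refl → e∉N (p─q⊆p (N G v) P x∈) })) ⟩
      ∣ Q ─ P - e ∣          <⟨ ℕ.≤-reflexive (sym (∣p∣≡1+∣p-x∣ e∈D)) ⟩
      ∣ Q ─ P ∣              ≡⟨ ∣D∣≡2 ⟩
      2                      ∎) (ℕ.<-irrefl refl)
      where
      open ℕ.≤-Reasoning
      -- Of the two neighbours of `v` outside `P`, `d` is in `Q`. So at most one is outside `Q`, and
      -- saturation of `Q` leaves none.
      N⊆Q : N G v ⊆ Q
      N⊆Q = few-outside⇒N⊆ satQ (P⊆Q v∈P) (ℕ.≤-pred (begin-strict
        ∣ N G v ─ Q ∣      ≤⟨ p⊆q⇒∣p∣≤∣q∣ {p = N G v ─ Q} {N G v ─ P - d} (λ x∈ →
                               x∈p∧x≢y⇒x∈p-y (─-monoʳ-⊇ (N G v) P⊆Q x∈)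
                               (λ { refl → x∈p─q⇒x∉q (N G v) Q x∈ (p─q⊆p Q P d∈D) })) ⟩
        ∣ N G v ─ P - d ∣  <⟨ ℕ.≤-reflexive (sym (∣p∣≡1+∣p-x∣
                               (x∈p∧x∉q⇒x∈p─q d∈N (x∈p─q⇒x∉q Q P d∈D)))) ⟩
        ∣ N G v ─ P ∣      ≡⟨ eq ⟩
        2                  ∎))

    -- A neighbour of `d` other than `e` lies in `Q` and is neither `d` nor `e`, hence is in `P`; by
    -- `both` it sees `e` as well.
    transfer : ∀ {d e} → d ∈ Q ─ P → e ∈ Q ─ P → (∀ {x} → x ∈ Q → x ∉ P → x ≡ d ⊎ x ≡ e) →
               N G d ⊆ Q → N G d - e ⊆ N G e - d
    transfer {d} {e} d∈D e∈D D⊆ N⊆Q {x} x∈ =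
      x∈p∧x≢y⇒x∈p-y (symmetric G (both x∈P (symmetric G x∈N) d∈D e∈D)) x≢d
      where
      x∈N : x ∈ N G d
      x∈N = p─q⊆p (N G d) ⁅ e ⁆ x∈
      x≢d : x ≢ d
      x≢d refl = irreflexive G x∈N
      x∈P : x ∈ P
      x∈P with x ∈? P
      ... | yes x∈P = x∈P
      ... | no x∉P  = contradiction (D⊆ (N⊆Q x∈N) x∉P) [ x≢d , x∈p-y⇒x≢y (N G d) x∈ ]′

    N-u⊆N-u′ : N G u - u′ ⊆ N G u′ - u
    N-u⊆N-u′ = transfer u∈D u′∈D D⊆ (N[u]⊆Q ∘ N⊆N[] G)

    N-u′⊆N-u : N G u′ - u ⊆ N G u - u′
    N-u′⊆N-u = transfer u′∈D u∈D (λ x∈Q x∉P → [ inj₂ , inj₁ ]′ (D⊆ x∈Q x∉P))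
      -- That `Q` contains the neighbours is given for `u` only. But `u′` shares at least two
      -- neighbours with `u`, which are in `Q`, so at most one neighbour of `u′` is outside `Q`,
      -- hence none.
      (few-outside⇒N⊆ satQ u′∈Q (ℕ.+-cancelˡ-≤ 2 _ _ (begin
        2 + ∣ N G u′ ─ Q ∣                ≤⟨ ℕ.+-monoˡ-≤ _ (ℕ.≤-pred (ℕ.≤-trans
                                              (ℕ.≤-reflexive (sym (cubic u)))
                                              (∣p∣≤1+∣p-x∣ (N G u) u′))) ⟩
        ∣ N G u - u′ ∣ + ∣ N G u′ ─ Q ∣   ≤⟨ ℕ.+-monoˡ-≤ _ (p⊆q⇒∣p∣≤∣q∣
                                              {p = N G u - u′} {N G u′ ∩ Q} common) ⟩
        ∣ N G u′ ∩ Q ∣ + ∣ N G u′ ─ Q ∣   ≡⟨ ∣p∣≡∣p∩q∣+∣p─q∣ (N G u′) Q ⟨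
        ∣ N G u′ ∣                        ≡⟨ cubic u′ ⟩
        3                                 ∎)))
      where
      open ℕ.≤-Reasoning
      common : N G u - u′ ⊆ N G u′ ∩ Q
      common x∈ = x∈p∩q⁺ (p─q⊆p (N G u′) ⁅ u ⁆ (N-u⊆N-u′ x∈)
                         , N[u]⊆Q (N⊆N[] G (p─q⊆p (N G u) ⁅ u′ ⁆ x∈)))

-- Recognizing a complete bipartite component.

module _ {n : ℕ} (G : Graph n) {a b : ℕ} (α : Fin (suc a) → Fin n) (β : Fin (suc b) → Fin n)
  (α-injective : ∀ {i j} → α i ≡ α j → i ≡ j) (β-injective : ∀ {i j} → β i ≡ β j → i ≡ j)
  (N-α : ∀ i {w} → w ∈ N G (α i) ⇔ (∃[ j ] β j ≡ w))
  (N-β : ∀ j {w} → w ∈ N G (β j) ⇔ (∃[ i ] α i ≡ w)) where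

  private
    K = completeBipartite (suc a) (suc b)

    -- By `N-α` and `N-β` a vertex of either part has the whole other part as its neighbourhood, so
    -- this is the union of the images of `α` and `β`.
    C : Subset n
    C = N G (α zero) ∪ N G (β zero)

    α→β : ∀ i j → β j ∈ N G (α i)
    α→β i j = Equivalence.from (N-α i) (j , refl)

    β→α : ∀ j i → α i ∈ N G (β j)
    β→α j i = Equivalence.from (N-β j) (i , refl)

    vertex : Fin (suc a) ⊎ Fin (suc b) → Fin n
    vertex = [ α , β ]′

    vertex∈C : ∀ s → vertex s ∈ C
    vertex∈C (inj₁ i) = x∈p∪q⁺ (inj₂ (β→α zero i))
    vertex∈C (inj₂ j) = x∈p∪q⁺ (inj₁ (α→β zero j))

    ∈C⇒vertex : ∀ {v} → v ∈ C → ∃[ s ] vertex s ≡ v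
    ∈C⇒vertex v∈ with x∈p∪q⁻ (N G (α zero)) _ v∈
    ... | inj₁ v∈Nα = let j , eq = Equivalence.to (N-α zero) v∈Nα in inj₂ j , eq
    ... | inj₂ v∈Nβ = let i , eq = Equivalence.to (N-β zero) v∈Nβ in inj₁ i , eq

    vertex-injective : ∀ s t → vertex s ≡ vertex t → s ≡ t
    vertex-injective (inj₁ i) (inj₁ j) eq = cong inj₁ (α-injective eq)
    vertex-injective (inj₂ i) (inj₂ j) eq = cong inj₂ (β-injective eq)
    -- Vertices of different parts are adjacent, so equality would give a loop.
    vertex-injective (inj₁ i) (inj₂ j) eq =
      contradiction (subst (_∈ N G (α i)) (sym eq) (α→β i j)) (irreflexive G)
    vertex-injective (inj₂ i) (inj₁ j) eq =
      contradiction (subst (_∈ N G (α j)) eq (α→β j i)) (irreflexive G)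

    connected : ∀ s t → Star (Adj G) (vertex s) (vertex t)
    connected (inj₁ i) (inj₁ j) = α→β i zero ◅ β→α zero j ◅ ε
    connected (inj₁ i) (inj₂ j) = α→β i j ◅ ε
    connected (inj₂ i) (inj₁ j) = β→α i j ◅ ε
    connected (inj₂ i) (inj₂ j) = β→α i zero ◅ α→β zero j ◅ ε

    closed : ∀ {v w} → v ∈ C → w ∈ N G v → w ∈ C
    closed v∈ w∈ with ∈C⇒vertex v∈
    ... | inj₁ i , refl with j , refl ← Equivalence.to (N-α i) w∈ = vertex∈C (inj₂ j)
    ... | inj₂ j , refl with i , refl ← Equivalence.to (N-β j) w∈ = vertex∈C (inj₁ i)

    reach : ∀ {v w} → v ∈ C → Star (Adj G) v w → w ∈ C
    reach v∈ ε        = v∈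
    reach v∈ (e ◅ es) = reach (closed v∈ e) es

    isLeft : ∀ {c} → Fin c → Bool
    isLeft v = does (toℕ v <? suc a)

    isLeft-join : ∀ s → isLeft (join (suc a) (suc b) s) ≡ [ (λ _ → true) , (λ _ → false) ]′ s
    isLeft-join (inj₁ i) = dec-true (_ <? suc a)
      (subst (_< suc a) (sym (Fin.toℕ-↑ˡ i (suc b))) (Fin.toℕ<n i))
    isLeft-join (inj₂ j) = dec-false (_ <? suc a)
      (ℕ.≤⇒≯ (subst (suc a ≤_) (sym (Fin.toℕ-↑ʳ (suc a) j)) (ℕ.m≤m+n (suc a) _)))

    -- `adj-K` and `adj-G` reduce adjacency in the two graphs to the same Boolean test, that the
    -- sides differ; composing them gives the isomorphism.
    adj-K : ∀ s t → Adj K (join _ _ s) (join _ _ t) ⇔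
            [ (λ _ → true) , (λ _ → false) ]′ s xor [ (λ _ → true) , (λ _ → false) ]′ t ≡ true
    adj-K s t rewrite sym (isLeft-join s) | sym (isLeft-join t) =
      ∈-tabulate {f = λ w → isLeft (join (suc a) (suc b) s) xor isLeft w}

    adj-G : ∀ s t → Adj G (vertex s) (vertex t) ⇔
            [ (λ _ → true) , (λ _ → false) ]′ s xor [ (λ _ → true) , (λ _ → false) ]′ t ≡ true
    adj-G (inj₁ i) (inj₂ j) = mk⇔ (λ _ → refl) (λ _ → α→β i j)
    adj-G (inj₂ j) (inj₁ i) = mk⇔ (λ _ → refl) (λ _ → β→α j i)
    adj-G (inj₁ i) (inj₁ j) = mk⇔ (λ αj∈ → contradiction
      (let k , eq = Equivalence.to (N-α i) αj∈ in vertex-injective (inj₂ k) (inj₁ j) eq) λ ()) λ ()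
    adj-G (inj₂ i) (inj₂ j) = mk⇔ (λ βj∈ → contradiction
      (let k , eq = Equivalence.to (N-β i) βj∈ in vertex-injective (inj₁ k) (inj₂ j) eq) λ ()) λ ()

  completeBipartite-component : HasComponentIsoTo G K
  completeBipartite-component =
    C , ((_ , vertex∈C (inj₁ zero)) , component) , record
      { bijection = ⤖⇒↔ (mk⤖ {to = to} (to-injective , strictlySurjective⇒surjective to-surjective))
      ; adjacency = λ x y → subst₂ (λ x′ y′ → Adj K x′ y′ ⇔ Adj G (proj₁ (to x)) (proj₁ (to y)))
          (Fin.join-splitAt (suc a) (suc b) x) (Fin.join-splitAt (suc a) (suc b) y)
          (⇔-sym (adj-G (splitAt (suc a) x) (splitAt (suc a) y)) ⇔-∘
            adj-K (splitAt (suc a) x) (splitAt (suc a) y))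
      }
    where
    component : ∀ {v} → v ∈ C → ∀ w → w ∈ C ⇔ Star (Adj G) v w
    component v∈ w = mk⇔ to′ (reach v∈)
      where
      to′ : w ∈ C → Star (Adj G) _ w
      to′ w∈ with s , refl ← ∈C⇒vertex v∈ | t , refl ← ∈C⇒vertex w∈ = connected s t

    to : Fin (suc a + suc b) → ∃[ v ] v ∈ C
    to x = vertex (splitAt (suc a) x) , vertex∈C (splitAt (suc a) x)

    to-injective : ∀ {x y} → to x ≡ to y → x ≡ y
    to-injective {x} {y} eq = begin
      x                                         ≡⟨ Fin.join-splitAt (suc a) (suc b) x ⟨
      join (suc a) (suc b) (splitAt (suc a) x)  ≡⟨ cong (join (suc a) (suc b)) (vertex-injective
                                                    (splitAt (suc a) x) (splitAt (suc a) y)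
                                                    (cong proj₁ eq)) ⟩
      join (suc a) (suc b) (splitAt (suc a) y)  ≡⟨ Fin.join-splitAt (suc a) (suc b) y ⟩
      y                                         ∎
      where open ≡-Reasoning

    to-surjective : ∀ y → ∃[ x ] to x ≡ y
    to-surjective (v , v∈) =
      let s , eq = ∈C⇒vertex v∈
      in  join (suc a) (suc b) s
        , Σ-≡,≡→≡ (trans (cong vertex (Fin.splitAt-join (suc a) (suc b) s)) eq , []=-irrelevant _ _)

-- Each of the three shared neighbours is adjacent to `a`, `b` and `c`, and degree three leaves it
-- no other neighbour.
shared-neighbourhood⇒K₃,₃ : (G : Graph n) → IsRegular 3 G → ∀ {a b c} →
  a ≢ b → a ≢ c → b ≢ c → N G a ≡ N G b → N G a ≡ N G c →
  HasComponentIsoTo G (completeBipartite 3 3)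
shared-neighbourhood⇒K₃,₃ G cubic {a} {b} {c} a≢b a≢c b≢c Na≡Nb Na≡Nc
  with ys , ys-unique , ys∈ ← elements 3 (N G a) (cubic a) =
  completeBipartite-component G (lookup xs) (lookup ys)
    (Unique.lookup-injective xs-unique _ _) (Unique.lookup-injective ys-unique _ _)
    (λ i → neighbours ys-unique (All.map (∈N-x i) ys∈))
    (λ j → neighbours xs-unique (All.lookup⁻ λ i → symmetric G (∈N-x i (All.lookup⁺ ys∈ j))))
  where
  xs : Vec (Fin _) 3
  xs = a ∷ b ∷ c ∷ []

  xs-unique : Unique xs
  xs-unique = (a≢b ∷ a≢c ∷ []) ∷ (b≢c ∷ []) ∷ [] ∷ []

  ∈N-x : ∀ i {y} → y ∈ N G a → y ∈ N G (lookup xs i)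
  ∈N-x zero             y∈ = y∈
  ∈N-x (suc zero)       y∈ = subst (_ ∈_) Na≡Nb y∈
  ∈N-x (suc (suc zero)) y∈ = subst (_ ∈_) Na≡Nc y∈

  neighbours : ∀ {v} {zs : Vec (Fin _) 3} → Unique zs → All (_∈ N G v) zs →
               ∀ {w} → w ∈ N G v ⇔ (∃[ i ] lookup zs i ≡ w)
  neighbours {v} {zs} unique zs∈ {w} = mk⇔
    (λ w∈ → let w∈zs = Unique⇒exhausts unique zs∈ (ℕ.≤-reflexive (cubic v)) w∈
            in  Any.index w∈zs , sym (Any.lookup-index w∈zs))
    (λ { (i , refl) → All.lookup⁺ zs∈ i })

-- Twins near twins, and a packing of twin neighbourhoods.

module _ {n : ℕ} (G : Graph n) (cubic : IsRegular 3 G) where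
  open Cubic G cubic

  twins? : ∀ u v → Dec (Twins u v)
  twins? u v = ¬? (u Fin.≟ v) ×-dec Vec.≡-dec Bool._≟_ (N G u - v) (N G v - u)

  Twins-sym : ∀ {u v} → Twins u v → Twins v u
  Twins-sym (u≢v , eq) = u≢v ∘ sym , sym eq

  Twins-N : ∀ {u v x} → Twins u v → x ≢ v → x ∈ N G u → x ∈ N G v
  Twins-N {u} {v} (_ , eq) x≢v x∈ =
    p─q⊆p (N G v) ⁅ u ⁆ (subst (_ ∈_) eq (x∈p∧x≢y⇒x∈p-y x∈ x≢v))

  nonadjacent-twins : ∀ {u v} → Twins u v → v ∉ N G u → N G u ≡ N G v
  nonadjacent-twins tw v∉ = ⊆-antisym
    (λ x∈ → Twins-N tw (λ { refl → v∉ x∈ }) x∈)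
    (λ x∈ → Twins-N (Twins-sym tw) (λ { refl → v∉ (symmetric G x∈) }) x∈)

  -- A common neighbour of s and u sees s, its twin, u and u′, hence s′ is u or u′ and
  -- the three vertices s, u and u′ share their neighbourhood.
  twins-near-twin⇒K₃,₃ : ∀ {P u u′ s s′ x} → u ∉ P → u′ ∉ P → N[_] G s ⊆ P →
    Twins u u′ → Twins s s′ → x ∈ N[_] G u → x ∈ N[_] G s →
    HasComponentIsoTo G (completeBipartite 3 3)
  twins-near-twin⇒K₃,₃ {P} {u} {u′} {s} {s′} {x} u∉P u′∉P N[s]⊆P uu′ ss′ x∈N[u] x∈N[s] =
    cases (Unique⇒exhausts ((proj₁ uu′ ∷ u≢s ∷ []) ∷ (u′≢s ∷ []) ∷ [] ∷ [])
      (symmetric G x∈u ∷ symmetric G x∈u′ ∷ symmetric G x∈s ∷ [])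
      (ℕ.≤-reflexive (cubic x)) (symmetric G x∈s′))
    where
    ∈P⇒≢ : ∀ {v w} → v ∉ P → w ∈ P → w ≢ v
    ∈P⇒≢ v∉ w∈ refl = v∉ w∈

    u≢s : u ≢ s
    u≢s = ∈P⇒≢ u∉P (N[s]⊆P (s∈N[s] G)) ∘ sym
    u′≢s : u′ ≢ s
    u′≢s = ∈P⇒≢ u′∉P (N[s]⊆P (s∈N[s] G)) ∘ sym

    u∉N-s : u ∉ N G s
    u∉N-s = u∉P ∘ N[s]⊆P ∘ N⊆N[] G

    x∈u : x ∈ N G u
    x∈u = ∈-N[]⁻ G x∈N[u] (∈P⇒≢ u∉P (N[s]⊆P x∈N[s]))
    x∈u′ : x ∈ N G u′
    x∈u′ = Twins-N uu′ (∈P⇒≢ u′∉P (N[s]⊆P x∈N[s])) x∈u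
    x∈s : x ∈ N G s
    x∈s = ∈-N[]⁻ G x∈N[s] λ { refl → u∉N-s (symmetric G x∈u) }
    x∈s′ : x ∈ N G s′
    -- If `x` were `s′`, then `u` would be adjacent to `s′`, hence to its twin `s`, and so lie in
    -- `P`.
    x∈s′ = Twins-N ss′ (λ { refl → u∉N-s (Twins-N (Twins-sym ss′) u≢s (symmetric G x∈u)) }) x∈s

    -- Neither pair of twins is adjacent: `u` is outside `P` and so not next to `s`, and if `u′`
    -- were next to `u` it would be next to the twin `s` of `u`.
    finish : ∀ {u u′} → u ∉ P → u′ ∉ P → Twins u u′ → Twins s u →
             HasComponentIsoTo G (completeBipartite 3 3)
    finish {u} {u′} u∉P u′∉P uu′ su = shared-neighbourhood⇒K₃,₃ G cubic
      (∈P⇒≢ u∉P s∈P) (∈P⇒≢ u′∉P s∈P) (proj₁ uu′) Ns≡Nu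
      (trans Ns≡Nu (nonadjacent-twins uu′ λ u′∈ → u′∉P (N[s]⊆P (N⊆N[] G
        (Twins-N (Twins-sym su) (∈P⇒≢ u′∉P s∈P ∘ sym) u′∈)))))
      where
      s∈P : s ∈ P
      s∈P = N[s]⊆P (s∈N[s] G)
      Ns≡Nu : N G s ≡ N G u
      Ns≡Nu = nonadjacent-twins su (u∉P ∘ N[s]⊆P ∘ N⊆N[] G)

    cases : s′ ∈ᵛ u ∷ u′ ∷ s ∷ [] → HasComponentIsoTo G (completeBipartite 3 3)
    cases (here refl)                 = finish u∉P u′∉P uu′ ss′
    cases (there (here refl))         = finish u′∉P u∉P (Twins-sym uu′) ss′
    cases (there (there (here refl))) = contradiction refl (proj₁ ss′)

  HasTwin : Fin n → Set
  HasTwin u = ∃[ v ] Twins u v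

  ∣N[u]∣≥4 : ∀ u → 4 ≤ ∣ N[_] G u ∣
  ∣N[u]∣≥4 u = begin
    3 + 1                    ≡⟨ cong₂ _+_ (cubic u) (∣⁅x⁆∣≡1 u) ⟨
    ∣ N G u ∣ + ∣ ⁅ u ⁆ ∣    ≤⟨ disjoint⇒∣p∣+∣q∣≤∣p∪q∣ (N G u) ⁅ u ⁆ (λ (x , x∈) →
                                 let x∈N , x∈u = x∈p∩q⁻ (N G u) ⁅ u ⁆ x∈ in
                                 irreflexive G (subst (_∈ N G u) (x∈⁅y⁆⇒x≡y u x∈u) x∈N)) ⟩
    ∣ N[_] G u ∣             ∎
    where open ℕ.≤-Reasoning

  -- Bookkeeping for both greedy constructions below: a new member of `S` is paid for by four newly
  -- covered vertices.
  4*∣S∪u∣≤ : ∀ (S : Subset n) u {i j} → 4 * ∣ S ∣ ≤ i → 4 + i ≤ j → 4 * ∣ S ∪ ⁅ u ⁆ ∣ ≤ j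
  4*∣S∪u∣≤ S u {i} {j} 4∣S∣≤i 4+i≤j = begin
    4 * ∣ S ∪ ⁅ u ⁆ ∣  ≤⟨ ℕ.*-monoʳ-≤ 4 (∣p∪q∣≤∣p∣+∣q∣ S ⁅ u ⁆) ⟩
    4 * (∣ S ∣ + ∣ ⁅ u ⁆ ∣) ≡⟨ cong (λ k → 4 * (∣ S ∣ + k)) (∣⁅x⁆∣≡1 u) ⟩
    4 * (∣ S ∣ + 1)    ≡⟨ cong (4 *_) (ℕ.+-comm ∣ S ∣ 1) ⟩
    4 * suc ∣ S ∣      ≡⟨ ℕ.*-suc 4 ∣ S ∣ ⟩
    4 + 4 * ∣ S ∣      ≤⟨ ℕ.+-monoʳ-≤ 4 4∣S∣≤i ⟩
    4 + i              ≤⟨ 4+i≤j ⟩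
    j                  ∎
    where open ℕ.≤-Reasoning

  -- Greedy choice: a vertex with a twin is added while its closed neighbourhood avoids those chosen
  -- so far. As closed neighbourhoods have four vertices, the inequality records that they are
  -- disjoint.
  twin-packing : ∃[ S ] 4 * ∣ S ∣ ≤ ∣ N[[_]] G S ∣ × (∀ {s} → s ∈ S → HasTwin s) ×
                 (∀ {u} → HasTwin u → Nonempty (N[_] G u ∩ N[[_]] G S))
  twin-packing = extend ⊥ (⊃-wellFounded ⊥)
    (ℕ.≤-trans (ℕ.≤-reflexive (cong (4 *_) (∣⊥∣≡0 n))) z≤n) (λ s∈ → contradiction s∈ ∉⊥)
    where
    extend : ∀ S → Acc _⊃_ S → 4 * ∣ S ∣ ≤ ∣ N[[_]] G S ∣ → (∀ {s} → s ∈ S → HasTwin s) →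
             ∃[ S ] 4 * ∣ S ∣ ≤ ∣ N[[_]] G S ∣ × (∀ {s} → s ∈ S → HasTwin s) ×
             (∀ {u} → HasTwin u → Nonempty (N[_] G u ∩ N[[_]] G S))
    extend S (acc rec) 4∣S∣≤ twinned
      with Fin.any? (λ u → Fin.any? (twins? u) ×-dec ¬? (nonempty? (N[_] G u ∩ N[[_]] G S)))
    ... | no none = S , 4∣S∣≤ , twinned , λ {u} tw → decidable-stable
      (nonempty? (N[_] G u ∩ N[[_]] G S)) (λ empty → none (u , tw , empty))
    ... | yes (u , tw , disjoint) = extend (S ∪ ⁅ u ⁆)
      (rec (p⊆p∪q ⁅ u ⁆ , u , x∈p∪q⁺ (inj₂ (x∈⁅x⁆ u)) , u∉S))
      (4*∣S∪u∣≤ S u 4∣S∣≤ (begin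
        4 + ∣ N[[_]] G S ∣             ≤⟨ ℕ.+-monoˡ-≤ _ (∣N[u]∣≥4 u) ⟩
        ∣ N[_] G u ∣ + ∣ N[[_]] G S ∣  ≤⟨ disjoint⇒∣p∣+∣q∣≤∣p∪q∣ (N[_] G u) (N[[_]] G S) disjoint ⟩
        ∣ N[_] G u ∪ N[[_]] G S ∣      ≤⟨ p⊆q⇒∣p∣≤∣q∣ {p = N[_] G u ∪ N[[_]] G S}
                                           {N[[_]] G (S ∪ ⁅ u ⁆)} grow ⟩
        ∣ N[[_]] G (S ∪ ⁅ u ⁆) ∣       ∎))
      (λ s∈ → [ twinned , (λ s∈u → subst HasTwin (sym (x∈⁅y⁆⇒x≡y u s∈u)) tw) ]′
                (x∈p∪q⁻ S ⁅ u ⁆ s∈))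
      where
      open ℕ.≤-Reasoning
      u∉S : u ∉ S
      u∉S u∈S = disjoint (u , x∈p∩q⁺ (s∈N[s] G , ∈-N[[]]⁺ G u∈S (s∈N[s] G)))
      grow : N[_] G u ∪ N[[_]] G S ⊆ N[[_]] G (S ∪ ⁅ u ⁆)
      grow x∈ = [ ∈-N[[]]⁺ G (x∈p∪q⁺ (inj₂ (x∈⁅x⁆ u))) , N[[]]-mono G (p⊆p∪q ⁅ u ⁆) ]′
        (x∈p∪q⁻ (N[_] G u) (N[[_]] G S) x∈)

  -- The quarter bound for the graph itself.

  γP≤n/4 : ¬ HasComponentIsoTo G (completeBipartite 3 3) → γP G ≤ n / 4
  γP≤n/4 noK₃,₃ =
    let T , dom , 4∣T∣≤n = extend S₀ (⊃-wellFounded _) (λ s∈ → s∈)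
          (ℕ.≤-trans 4∣S₀∣≤ (p⊆q⇒∣p∣≤∣q∣ {p = N[[_]] G S₀} {PD G S₀} (N[[]]⊆PD G S₀)))
    in  ℕ.≤-trans (γP≤ G dom) (m≤n/4 ∣ T ∣ 4∣T∣≤n)
    where
    m≤n/4 : ∀ m → 4 * m ≤ n → m ≤ n / 4
    m≤n/4 m 4m≤n = subst (_≤ n / 4) (m*n/n≡m m 4)
      (/-monoˡ-≤ 4 (subst (_≤ n) (ℕ.*-comm 4 m) 4m≤n))

    packing = twin-packing
    S₀ = proj₁ packing
    4∣S₀∣≤ = proj₁ (proj₂ packing)
    twinned = proj₁ (proj₂ (proj₂ packing))
    maximal = proj₂ (proj₂ (proj₂ packing))

    -- A smaller gain would give `u` a twin outside `PD G S`. By maximality of the packing, `u` is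
    -- then near a twinned `s` in `S₀`, whose closed neighbourhood is inside `PD G S`.
    gain : ∀ {S u} → S₀ ⊆ S → u ∉ PD G S → 4 + ∣ PD G S ∣ ≤ ∣ PD G (S ∪ ⁅ u ⁆) ∣
    gain {S} {u} S₀⊆S u∉P with 4 + ∣ PD G S ∣ ℕ.≤? ∣ PD G (S ∪ ⁅ u ⁆) ∣
    ... | yes 4+≤ = 4+≤
    ... | no  4+≰ = contradiction K₃,₃ noK₃,₃
      where
      K₃,₃ : HasComponentIsoTo G (completeBipartite 3 3)
      K₃,₃ =
        let u′ , u′∉P , uu′ = small-extension⇒twins (PD-saturated S) (PD-saturated (S ∪ ⁅ u ⁆))
              (PD-mono G (p⊆p∪q ⁅ u ⁆)) (N[]⊆PD G (x∈p∪q⁺ (inj₂ (x∈⁅x⁆ u)))) u∉P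
              (subst (∣ PD G (S ∪ ⁅ u ⁆) ∣ <_) (ℕ.+-comm 4 ∣ PD G S ∣) (ℕ.≰⇒> 4+≰))
            x , x∈ = maximal (u′ , uu′)
            x∈N[u] , x∈N[[S₀]] = x∈p∩q⁻ (N[_] G u) (N[[_]] G S₀) x∈
            s , s∈S₀ , x∈N[s] = ∈-N[[]]⁻ G x∈N[[S₀]]
        in  twins-near-twin⇒K₃,₃ u∉P u′∉P (N[]⊆PD G (S₀⊆S s∈S₀)) uu′ (proj₂ (twinned s∈S₀))
              x∈N[u] x∈N[s]

    -- The recursion is on the growing set `PD G S`; once it contains every vertex, the invariant
    -- bounds `4 * ∣ S ∣` by `n`.
    extend : ∀ S → Acc _⊃_ (PD G S) → S₀ ⊆ S → 4 * ∣ S ∣ ≤ ∣ PD G S ∣ →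
             ∃[ T ] IsPowerDominating G T × 4 * ∣ T ∣ ≤ n
    extend S (acc rec) S₀⊆S 4∣S∣≤ with Fin.any? (λ u → ¬? (u ∈? PD G S))
    ... | no all∈ = S , dominating G (λ x → decidable-stable (x ∈? PD G S) λ x∉ → all∈ (x , x∉))
                  , ℕ.≤-trans 4∣S∣≤ (∣p∣≤n (PD G S))
    ... | yes (u , u∉P) = extend (S ∪ ⁅ u ⁆)
      (rec (PD-mono G (p⊆p∪q ⁅ u ⁆) , u , N[]⊆PD G (x∈p∪q⁺ (inj₂ (x∈⁅x⁆ u))) (s∈N[s] G) , u∉P))
      (p⊆p∪q ⁅ u ⁆ ∘ S₀⊆S)
      (4*∣S∪u∣≤ S u 4∣S∣≤ (gain S₀⊆S u∉P))

  -- Power domination of the complement by two vertices.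

  module _ (n≥6 : n ≥ 6) where

    private
      open ℕ.≤-Reasoning

      ∣N∪N-u∣<n : ∀ a {b u} → b ∈ N G u → ∣ N G a ∪ (N G b - u) ∣ < n
      ∣N∪N-u∣<n a {b} {u} b∈ = begin-strict
        ∣ N G a ∪ (N G b - u) ∣      ≤⟨ ∣p∪q∣≤∣p∣+∣q∣ (N G a) _ ⟩
        ∣ N G a ∣ + ∣ N G b - u ∣    ≡⟨ cong₂ _+_ (cubic a) (ℕ.suc-injective
                                         (trans (sym (∣p∣≡1+∣p-x∣ (symmetric G b∈))) (cubic b))) ⟩
        5                            <⟨ n≥6 ⟩
        n                            ∎

      ∣N[]∣<n : ∀ x → ∣ N[_] G x ∣ < n
      ∣N[]∣<n x = begin-strict
        ∣ N[_] G x ∣            ≤⟨ ∣p∪q∣≤∣p∣+∣q∣ (N G x) ⁅ x ⁆ ⟩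
        ∣ N G x ∣ + ∣ ⁅ x ⁆ ∣   ≡⟨ cong₂ _+_ (cubic x) (∣⁅x⁆∣≡1 x) ⟩
        4                       <⟨ ℕ.n<1+n 4 ⟩
        5                       <⟨ n≥6 ⟩
        n                       ∎

    -- N a ∪ N b has at most five elements, because u is in both sets.
    few-common-neighbours : ∀ u → ∃[ v ] (∀ {x y} → x ∈ N G u → x ∈ N G v →
                                          y ∈ N G u → y ∈ N G v → y ≡ x)
    few-common-neighbours u
      with a ∷ b ∷ _ ∷ [] , (a≢b ∷ _) ∷ _ , a∈ ∷ b∈ ∷ _ ← elements 3 (N G u) (cubic u)
      with v , v∉ ← ∣p∣<n⇒∃∉ (N G a ∪ (N G b - u)) (∣N∪N-u∣<n a b∈)
      = v , unique
      where
      v∉Na : v ∉ N G a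
      v∉Na = v∉ ∘ x∈p∪q⁺ ∘ inj₁
      v∉Nb : v ∉ N G b
      -- Deleting `u` from `N G b` loses nothing, because `u` is already excluded as a member of
      -- `N G a`.
      v∉Nb v∈ = v∉ (x∈p∪q⁺ (inj₂ (x∈p∧x≢y⇒x∈p-y v∈ λ v≡u →
        v∉Na (subst (_∈ N G a) (sym v≡u) (symmetric G a∈)))))

      a≢ : ∀ {z} → z ∈ N G v → a ≢ z
      a≢ z∈ refl = v∉Na (symmetric G z∈)
      b≢ : ∀ {z} → z ∈ N G v → b ≢ z
      b≢ z∈ refl = v∉Nb (symmetric G z∈)

      unique : ∀ {x y} → x ∈ N G u → x ∈ N G v → y ∈ N G u → y ∈ N G v → y ≡ x
      unique x∈u x∈v y∈u y∈v with Unique⇒exhausts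
        ((a≢b ∷ a≢ x∈v ∷ []) ∷ (b≢ x∈v ∷ []) ∷ [] ∷ []) (a∈ ∷ b∈ ∷ x∈u ∷ [])
        (ℕ.≤-reflexive (cubic u)) y∈u
      ... | here y≡a                 = contradiction (sym y≡a) (a≢ y∈v)
      ... | there (here y≡b)         = contradiction (sym y≡b) (b≢ y∈v)
      ... | there (there (here y≡x)) = y≡x

    -- If `x` is the only vertex missing, some `w` outside the closed neighbourhood of `x` in `G` is
    -- in `P` and sees `x` in the complement, so it would be active.
    final-complement : ∀ {P} → Final (complement G) P → (∀ {x y} → x ∉ P → y ∉ P → y ≡ x) →
                       ∀ x → x ∈ P
    final-complement {P} final unique x with x ∈? P
    ... | yes x∈ = x∈
    ... | no  x∉ with w , w∉ ← ∣p∣<n⇒∃∉ (N[_] G x) (∣N[]∣<n x)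
        = contradiction (w∈P , ℕ.≤-antisym
            (ℕ.≤-trans (p⊆q⇒∣p∣≤∣q∣ {p = N (complement G) w ─ P} {⁅ x ⁆} only)
              (ℕ.≤-reflexive (∣⁅x⁆∣≡1 x)))
            (ℕ.≤-trans (s≤s z≤n)
              (ℕ.≤-reflexive (sym (∣p∣≡1+∣p-x∣ (x∈p∧x∉q⇒x∈p─q x∈N-w x∉))))))
          (final w)
      where
      x∈N-w : x ∈ N (complement G) w
      x∈N-w = symmetric (complement G) {x} (x∉p⇒x∈∁p w∉)
      w∈P : w ∈ P
      w∈P = decidable-stable (w ∈? P) λ w∉P →
        w∉ (subst (_∈ N[_] G x) (sym (unique x∉ w∉P)) (s∈N[s] G))
      only : N (complement G) w ─ P ⊆ ⁅ x ⁆
      only z∈ = subst (_∈ ⁅ x ⁆)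
        (sym (unique x∉ (x∈p─q⇒x∉q (N (complement G) w) P z∈))) (x∈⁅x⁆ x)

    γP-complement≤2 : γP (complement G) ≤ 2
    γP-complement≤2 = let v , unique = few-common-neighbours u in
      ℕ.≤-trans (γP≤ (complement G) (power-dominating unique)) (begin
        ∣ ⁅ u ⁆ ∪ ⁅ v ⁆ ∣         ≤⟨ ∣p∪q∣≤∣p∣+∣q∣ ⁅ u ⁆ ⁅ v ⁆ ⟩
        ∣ ⁅ u ⁆ ∣ + ∣ ⁅ v ⁆ ∣     ≡⟨ cong₂ _+_ (∣⁅x⁆∣≡1 u) (∣⁅x⁆∣≡1 v) ⟩
        2                         ∎)
      where
      u : Fin n
      u = fromℕ< (ℕ.≤-trans (s≤s z≤n) n≥6)

      -- Applied to both `u` and `v`, this makes every missing vertex a common neighbour of the two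
      -- in `G`.
      undominated : ∀ {S s x} → s ∈ S → x ∉ PD (complement G) S → x ∈ N G s
      undominated {s = s} {x} s∈S x∉ = decidable-stable (x ∈? N G s) λ x∉N →
        x∉ (N[]⊆PD (complement G) s∈S (∉N⇒∈N[]-complement G x∉N))

      power-dominating : ∀ {v} →
        (∀ {x y} → x ∈ N G u → x ∈ N G v → y ∈ N G u → y ∈ N G v → y ≡ x) →
        IsPowerDominating (complement G) (⁅ u ⁆ ∪ ⁅ v ⁆)
      power-dominating {v} unique = dominating (complement G) (final-complement
        (PD-final (complement G) _)
        λ x∉ y∉ → unique (undominated u∈ x∉) (undominated v∈ x∉)
                         (undominated u∈ y∉) (undominated v∈ y∉))
        where
        u∈ : u ∈ ⁅ u ⁆ ∪ ⁅ v ⁆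
        u∈ = x∈p∪q⁺ (inj₁ (x∈⁅x⁆ u))
        v∈ : v ∈ ⁅ u ⁆ ∪ ⁅ v ⁆
        v∈ = x∈p∪q⁺ (inj₂ (x∈⁅x⁆ v))

  γP*γP-complement≤ : n ≥ 6 → ¬ HasComponentIsoTo G (completeBipartite 3 3) →
                      γP G * γP (complement G) ≤ 2 * (n / 4)
  γP*γP-complement≤ n≥6 noK₃,₃ = subst (γP G * γP (complement G) ≤_) (ℕ.*-comm (n / 4) 2)
    (ℕ.*-mono-≤ (γP≤n/4 noK₃,₃) (γP-complement≤2 n≥6))

-- Sharpness: disjoint unions of copies of K₄.

module DisjointK₄ (k : ℕ) where

  blockOf : Fin (k * 4) → Fin k
  blockOf = quotient 4

  block : Fin k → Subset (k * 4)
  block i = tabulate λ v → does (blockOf v Fin.≟ i)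

  ∈-block⁺ : ∀ {v i} → blockOf v ≡ i → v ∈ block i
  ∈-block⁺ {v} {i} eq = Equivalence.from ∈-tabulate (dec-true (blockOf v Fin.≟ i) eq)

  ∈-block⁻ : ∀ {v i} → v ∈ block i → blockOf v ≡ i
  ∈-block⁻ {v} {i} v∈ with blockOf v Fin.≟ i | Equivalence.to ∈-tabulate v∈
  ... | yes eq | _ = eq

  -- `combine i` enumerates the block: it reaches every member, for the upper bound, and is
  -- injective, for the lower bound.
  ∣block∣ : ∀ i → ∣ block i ∣ ≡ 4
  ∣block∣ i = ℕ.≤-antisym
    (covered⇒∣p∣≤length {xs = tabulate (combine i)} λ {v} v∈ → subst (_∈ᵛ tabulate (combine i))
      (trans (cong (λ j → combine j (remainder {k} 4 v)) (sym (∈-block⁻ v∈)))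
        (Fin.combine-remQuot {k} 4 v))
      (∈-tabulate⁺ (combine i) (remainder {k} 4 v)))
    (Unique⇒length≤∣p∣ (Unique.tabulate⁺ λ {j} {j′} → Fin.combine-injectiveʳ i j i j′)
      (All.tabulate⁺ λ j → ∈-block⁺ (blockOf-combine i j)))
    where
    blockOf-combine : ∀ i j → blockOf (combine i j) ≡ i
    blockOf-combine i j = cong proj₁ (Fin.remQuot-combine i j)

  graph : Graph (k * 4)
  graph = record
    { N           = λ v → block (blockOf v) - v
    ; symmetric   = λ {v} {w} w∈ → x∈p∧x≢y⇒x∈p-y
        (∈-block⁺ (sym (∈-block⁻ (p─q⊆p (block (blockOf v)) ⁅ v ⁆ w∈))))
        (x∈p-y⇒x≢y (block (blockOf v)) w∈ ∘ sym)
    ; irreflexive = λ {v} v∈ → x∈p-y⇒x≢y (block (blockOf v)) v∈ refl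
    }

  adjacent⁺ : ∀ {v w} → blockOf w ≡ blockOf v → w ≢ v → w ∈ N graph v
  adjacent⁺ eq w≢v = x∈p∧x≢y⇒x∈p-y (∈-block⁺ eq) w≢v

  adjacent⁻ : ∀ {v w} → w ∈ N graph v → blockOf w ≡ blockOf v
  adjacent⁻ {v} w∈ = ∈-block⁻ (p─q⊆p (block (blockOf v)) ⁅ v ⁆ w∈)

  cubic : IsRegular 3 graph
  cubic v = ℕ.suc-injective (trans (sym (∣p∣≡1+∣p-x∣ (∈-block⁺ refl))) (∣block∣ (blockOf v)))

  -- The vertices 0 and 1 of K₃,₃ are on the same side and not adjacent, whereas distinct vertices
  -- of one component here share a block and are adjacent.
  noK₃,₃ : ¬ HasComponentIsoTo graph (completeBipartite 3 3)
  noK₃,₃ (C , (_ , component) , iso) = contradiction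
    (Equivalence.from (adjacency zero (suc zero)) (adjacent⁺ same-block distinct)) λ { (there ()) }
    where
    open _≅_[_] iso

    reach-block : ∀ {v w} → Star (Adj graph) v w → blockOf w ≡ blockOf v
    reach-block ε        = refl
    reach-block (e ◅ es) = trans (reach-block es) (adjacent⁻ e)

    ∈C : ∀ x → vertex x ∈ C
    ∈C x = proj₂ (Inverse.to bijection x)

    same-block : blockOf (vertex (suc zero)) ≡ blockOf (vertex zero)
    same-block = reach-block (Equivalence.to (component (∈C zero) _) (∈C (suc zero)))

    distinct : vertex (suc zero) ≢ vertex zero
    distinct eq = contradiction (begin
      suc zero                                             ≡⟨ Inverse.strictlyInverseʳ bijection _ ⟨
      Inverse.from bijection (Inverse.to bijection (suc zero))
        ≡⟨ cong (Inverse.from bijection) (Σ-≡,≡→≡ (eq , []=-irrelevant _ _)) ⟩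
      Inverse.from bijection (Inverse.to bijection zero)   ≡⟨ Inverse.strictlyInverseʳ bijection _ ⟩
      zero                                                 ∎) λ ()
      where open ≡-Reasoning

  -- If `S` misses a block, the complement of the block contains all closed neighbourhoods of `S`
  -- and is final, since no edge enters the block from outside.
  meets-block : ∀ {S} → IsPowerDominating graph S → ∀ i → ∃[ s ] s ∈ S × blockOf s ≡ i
  meets-block {S} dom i with Fin.any? (λ s → s ∈? S ×-dec blockOf s Fin.≟ i)
  ... | yes found = found
  ... | no none   = contradiction (∈-block⁺ (cong proj₁ (Fin.remQuot-combine i zero)))
    (x∈∁p⇒x∉p (PD-least graph avoid final (subst (combine i zero ∈_) (sym dom) ∈⊤)))
    where
    avoid : ∀ {s} → s ∈ S → N[_] graph s ⊆ ∁ (block i)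
    avoid {s} s∈ x∈ = x∉p⇒x∈∁p λ x∈i → none (s , s∈ ,
      trans (sym ([ adjacent⁻ , (λ x∈s → cong blockOf (x∈⁅y⁆⇒x≡y s x∈s)) ]′ (x∈p∪q⁻ _ _ x∈)))
        (∈-block⁻ x∈i))

    final : Final graph (∁ (block i))
    final v (v∈ , eq) =
      let x , x∈ = ∣p∣≥1⇒Nonempty (ℕ.≤-reflexive (sym eq))
          x∈i = x∉∁p⇒x∈p (x∈p─q⇒x∉q (N graph v) _ x∈)
      in  x∈∁p⇒x∉p v∈ (∈-block⁺ (trans (sym (adjacent⁻ (p─q⊆p (N graph v) _ x∈))) (∈-block⁻ x∈i)))

  γP≥k : k ≤ γP graph
  γP≥k with S , dom , eq ← proj₁ (γP-correct graph) = subst (k ≤_) eq (Unique⇒length≤∣p∣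
    (Unique.tabulate⁺ λ {i} {j} si≡sj → trans (sym (proj₂ (proj₂ (meets-block dom i))))
      (trans (cong blockOf si≡sj) (proj₂ (proj₂ (meets-block dom j)))))
    (All.tabulate⁺ (proj₁ ∘ proj₂ ∘ meets-block dom)))

  -- In the complement, a vertex s dominates everything except its three neighbours in the graph, and
  -- every vertex sees none or all of these.
  singleton-not-dominating : ∀ {S s} → S ⊆ ⁅ s ⁆ → ¬ IsPowerDominating (complement graph) S
  singleton-not-dominating {S} {s} S⊆s dom =
    let x , x∈ = Cubic.neighbour graph cubic s
    in  x∈∁p⇒x∉p (PD-least Ḡ avoid final (subst (x ∈_) (sym dom) ∈⊤)) x∈
    where
    Ḡ = complement graph

    avoid-s : ∀ {x} → x ∈ N[_] Ḡ s → x ∉ N graph s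
    avoid-s x∈ x∈N = x∈∁p⇒x∉p
      (∈-N[]⁻ Ḡ {s} x∈ λ { refl → irreflexive graph x∈N }) (N⊆N[] graph x∈N)

    avoid : ∀ {t} → t ∈ S → N[_] Ḡ t ⊆ ∁ (N graph s)
    avoid t∈ x∈ with refl ← x∈⁅y⁆⇒x≡y s (S⊆s t∈) = x∉p⇒x∈∁p (avoid-s x∈)

    final : Final Ḡ (∁ (N graph s))
    final v (v∈ , eq) with blockOf v Fin.≟ blockOf s | v Fin.≟ s
    ... | yes same | no v≢s   = x∈∁p⇒x∉p v∈ (adjacent⁺ same v≢s)
    ... | _        | yes refl =
      let x , x∈ = ∣p∣≥1⇒Nonempty (ℕ.≤-reflexive (sym eq))
      in  avoid-s (N⊆N[] Ḡ {s} (p─q⊆p (N Ḡ s) _ x∈)) (x∉∁p⇒x∈p (x∈p─q⇒x∉q (N Ḡ s) _ x∈))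
    ... | no apart | no _     = contradiction (ℕ.≤-trans
      (ℕ.≤-reflexive (sym (cubic s)))
      (ℕ.≤-trans (p⊆q⇒∣p∣≤∣q∣ {p = N graph s} {N Ḡ v ─ ∁ (N graph s)} sees-all)
        (ℕ.≤-reflexive eq))) λ { (s≤s ()) }
      where
      sees-all : N graph s ⊆ N Ḡ v ─ ∁ (N graph s)
      sees-all x∈ = x∈p∧x∉q⇒x∈p─q
        (∈-complement graph (λ { refl → apart (adjacent⁻ x∈) })
          (λ x∈v → apart (trans (sym (adjacent⁻ x∈v)) (adjacent⁻ x∈))))
        (x∈p⇒x∉∁p x∈)

  -- A set with at most one element lies in a singleton; the given vertex supplies that singleton
  -- when the set is empty.
  γP-complement≥2 : Fin (k * 4) → 2 ≤ γP (complement graph)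
  γP-complement≥2 v with S , dom , eq ← proj₁ (γP-correct (complement graph)) =
    subst (2 ≤_) eq (ℕ.≮⇒≥ λ ∣S∣<2 → small dom (ℕ.≤-pred ∣S∣<2))
    where
    small : ∀ {S} → IsPowerDominating (complement graph) S → ¬ ∣ S ∣ ≤ 1
    small {S} dom ∣S∣≤1 with nonempty? S
    ... | no empty     = singleton-not-dominating {s = v} (λ t∈ → contradiction (_ , t∈) empty) dom
    ... | yes (s , s∈) = singleton-not-dominating S⊆s dom
      where
      S⊆s : S ⊆ ⁅ s ⁆
      S⊆s t∈ with here refl ← Unique⇒exhausts ([] ∷ []) (s∈ ∷ []) ∣S∣≤1 t∈ = x∈⁅x⁆ s

  attained : k * 4 ≥ 6 → γP graph * γP (complement graph) ≡ 2 * (k * 4 / 4)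
  attained 4k≥6 = ℕ.≤-antisym (γP*γP-complement≤ graph cubic 4k≥6 noK₃,₃) (begin
    2 * (k * 4 / 4)                      ≡⟨ cong (2 *_) (m*n/n≡m k 4) ⟩
    2 * k                                ≡⟨ ℕ.*-comm 2 k ⟩
    k * 2                                ≤⟨ ℕ.*-mono-≤ γP≥k (γP-complement≥2 (fromℕ< 4k≥6)) ⟩
    γP graph * γP (complement graph)     ∎)
    where open ℕ.≤-Reasoning

corollary4p7 : (∀ n → n ≥ 6 → (G : Graph n) → IsRegular 3 G →
    ¬ HasComponentIsoTo G (completeBipartite 3 3) →
    γP G * γP (complement G) ≤ 2 * (n / 4))
    ×
    (∀ n₀ → ∃[ n ] n ≥ n₀ × n ≥ 6 ×
    ∃[ G ] IsRegular {n} 3 G ×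
    ¬ HasComponentIsoTo G (completeBipartite 3 3) ×
    γP G * γP (complement G) ≡ 2 * (n / 4))
corollary4p7 =
    (λ n n≥6 G cubic → γP*γP-complement≤ G cubic n≥6)
  -- Two copies are the fewest that reach order six, and `n₀` more make the order exceed `n₀`.
  , λ n₀ → let open DisjointK₄ (2 + n₀)
               n≥6 = ℕ.m≤m+n 6 (2 + n₀ * 4)
           in  (2 + n₀) * 4 , ℕ.≤-trans (ℕ.m≤n+m n₀ 2) (ℕ.m≤m*n (2 + n₀) 4) , n≥6
             , graph , cubic , noK₃,₃ , attained n≥6
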